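{- Let $b$ and $n\ge 2$ be positive integers and let $h(x)=h_{n-2}x^{n-2}+\cdots+h_1x+h_0$ be a polynomial with complex coefficients of degree at most $n-2$. Then \[ \lim_{r\to\infty} \frac{\Phi_b^r\left(\frac{h(x)}{(1-x)^n}\right)}{b^{r(n-1)}} = \frac{A_{n-1}(x)\, h(1)}{(1-x)^n\,(n-1)!}, \] where $\Phi_b^r$ denotes the $r$-fold iterate of $\Phi_b$.
   Context: Let $\mathcal{R}$ be the space of rational functions in $x$ with complex coefficients. Every $R\in\mathcal{R}$ has a Laurent expansion at $x=0$, $R(x)=\sum_{n\gg-\infty} a_n x^n$ (only finitely many nonzero coefficients with negative index). For a positive integer $b$, the map $\Phi_b:\mathcal{R}\to\mathcal{R}$ is defined by $\Phi_b(R(x))=\sum_{n\gg -\infty} a_{bn+(b-1)}x^n$ (this is again a rational function). A permutation $\pi$ of $\{1,\dots,m\}$ has a descent at position $i$ ($1\le i\le m-1$) if $\pi(i)>\pi(i+1)$; the Eulerian number $A(m,k)$ is the number of permutations of $\{1,\dots,m\}$ with exactly $k$ descents, and the Eulerian polynomial is $A_m(x)=\sum_{k=0}^{m-1}A(m,k)x^k$.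
   Formalization: The formal theorem assumes b ≥ 2 as well as n ≥ 2; for b = 1 the map Φ_b is the identity and the claim fails, for example for n = 3 and h(x) = x. -}

module Defs where

open import Data.Nat.Base as ℕ using (ℕ; zero; suc; NonZero; NonTrivial)
import Data.Nat.Properties as ℕₚ
open import Data.Integer.Base as ℤ using (ℤ; +_; -[1+_])
open import Data.Rational.Base as ℚ using (ℚ; 0ℚ; 1ℚ; ½; ∣_∣; _<_; _≤_; _+_; _*_; _-_; -_; positive)
import Data.Rational.Properties as ℚₚ
import Algebra.Properties.CommutativeSemigroup as CommutativeSemigroupₚ
open import Algebra.Bundles using (CommutativeMonoid)
open import Data.Bool.Base using (if_then_else_)
open import Data.Fin.Base using (Fin)
import Data.Fin.Properties as Finₚ
open import Data.List.Base as List using (List; []; _∷_)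
open import Data.Vec.Base as Vec using (Vec; []; _∷_)
open import Data.Vec.Relation.Unary.AllPairs using (allPairs?)
open import Data.Vec.Relation.Unary.Unique.Propositional using (Unique)
open import Data.Product.Base using (Σ-syntax; _×_; _,_; proj₁; proj₂)
open import Relation.Nullary.Decidable using (Dec; ¬?; does)
open import Relation.Nullary.Negation using (¬_)
open import Relation.Binary.PropositionalEquality
  using (_≡_; refl; sym; trans; cong; cong₂; subst)

-- Real numbers are Cauchy sequences of rationals with a modulus of convergence
-- (the Σ), considered up to _≈ʳ_.

IsCauchy : (ℕ → ℚ) → Set
IsCauchy x = ∀ ε → 0ℚ < ε →
  Σ[ N ∈ ℕ ] (∀ m n → N ℕ.≤ m → N ℕ.≤ n → ∣ x m - x n ∣ < ε)

record ℝ : Set where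
  constructor mkℝ
  field
    seq    : ℕ → ℚ
    cauchy : IsCauchy seq

open ℝ public

infix 4 _≈ʳ_ _<ʳ_

record _≈ʳ_ (x y : ℝ) : Set where
  constructor mk≈ʳ
  field
    close : ∀ ε → 0ℚ < ε → Σ[ N ∈ ℕ ] (∀ n → N ℕ.≤ n → ∣ seq x n - seq y n ∣ < ε)

open _≈ʳ_ public

record _<ʳ_ (x y : ℝ) : Set where
  constructor mk<ʳ
  field
    gap    : ℚ
    gap>0  : 0ℚ < gap
    from   : ℕ
    apart  : ∀ n → from ℕ.≤ n → seq x n + gap ≤ seq y n

private
  open CommutativeSemigroupₚ (CommutativeMonoid.commutativeSemigroup ℚₚ.+-0-commutativeMonoid)
    using (interchange)

  half>0 : ∀ {ε} → 0ℚ < ε → 0ℚ < ½ * ε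
  half>0 0<ε = ℚₚ.*-monoʳ-<-pos ½ 0<ε

  halves : ∀ ε → ½ * ε + ½ * ε ≡ ε
  halves ε = trans (sym (ℚₚ.*-distribʳ-+ ε ½ ½)) (ℚₚ.*-identityˡ ε)

  +-diff : ∀ a b c d → (a + b) - (c + d) ≡ (a - c) + (b - d)
  +-diff a b c d = trans (cong (λ t → (a + b) + t) (ℚₚ.neg-distrib-+ c d)) (interchange a b (- c) (- d))

  neg-diff : ∀ a c → - a - - c ≡ - (a - c)
  neg-diff a c = sym (ℚₚ.neg-distrib-+ a (- c))

  telescope : ∀ a c d → (a - c) + (c - d) ≡ a - d
  telescope a c d = trans (ℚₚ.+-assoc a (- c) (c - d))
      (cong (λ t → a + t) (trans (sym (ℚₚ.+-assoc (- c) c (- d)))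
        (trans (cong (_- d) (ℚₚ.+-inverseˡ c)) (ℚₚ.+-identityˡ (- d)))))

  split-off : ∀ a c → a ≡ c + (a - c)
  split-off a c = trans (sym (ℚₚ.+-identityʳ a)) (trans (cong (λ t → a + t) (sym (ℚₚ.+-inverseˡ c)))
    (trans (sym (ℚₚ.+-assoc a (- c) c)) (ℚₚ.+-comm (a - c) c)))

  *-distrib-diff : ∀ a b d → a * (b - d) ≡ a * b - a * d
  *-distrib-diff a b d = trans (ℚₚ.*-distribˡ-+ a b (- d)) (cong (λ t → a * b + t) (sym (ℚₚ.neg-distribʳ-* a d)))

  *-diff : ∀ a b c d → a * b - c * d ≡ a * (b - d) + d * (a - c)
  *-diff a b c d = sym (trans (cong₂ _+_ (*-distrib-diff a b d) (*-distrib-diff d a c))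
    (trans (cong₂ (λ u v → (a * b - u) + (d * a - v)) (ℚₚ.*-comm a d) (ℚₚ.*-comm d c))
     (telescope (a * b) (d * a) (c * d))))

  +-cauchy : ∀ x y → IsCauchy x → IsCauchy y → IsCauchy (λ n → x n + y n)
  +-cauchy x y cx cy ε 0<ε
    with cx (½ * ε) (half>0 0<ε) | cy (½ * ε) (half>0 0<ε)
  ... | M , hx | N , hy = M ℕ.⊔ N , λ m n m≥ n≥ → begin-strict
        ∣ (x m + y m) - (x n + y n) ∣    ≡⟨ cong ∣_∣ (+-diff (x m) (y m) (x n) (y n)) ⟩
        ∣ (x m - x n) + (y m - y n) ∣    ≤⟨ ℚₚ.∣p+q∣≤∣p∣+∣q∣ (x m - x n) (y m - y n) ⟩
        ∣ x m - x n ∣ + ∣ y m - y n ∣    <⟨ ℚₚ.+-mono-< (hx m n (l m≥) (l n≥)) (hy m n (r m≥) (r n≥)) ⟩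
        ½ * ε + ½ * ε                    ≡⟨ halves ε ⟩
        ε                                ∎
    where
    open ℚₚ.≤-Reasoning
    l : ∀ {m} → M ℕ.⊔ N ℕ.≤ m → M ℕ.≤ m
    l = ℕₚ.≤-trans (ℕₚ.m≤m⊔n M N)
    r : ∀ {m} → M ℕ.⊔ N ℕ.≤ m → N ℕ.≤ m
    r = ℕₚ.≤-trans (ℕₚ.m≤n⊔m M N)

  neg-cauchy : ∀ x → IsCauchy x → IsCauchy (λ n → - x n)
  neg-cauchy x cx ε 0<ε with cx ε 0<ε
  ... | N , hx = N , λ m n m≥ n≥ → subst (_< ε)
        (sym (trans (cong ∣_∣ (neg-diff (x m) (x n))) (ℚₚ.∣-p∣≡∣p∣ (x m - x n))))
        (hx m n m≥ n≥)

  bound : ∀ x → IsCauchy x →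
    Σ[ B ∈ ℚ ] (0ℚ < B × (Σ[ N ∈ ℕ ] (∀ n → N ℕ.≤ n → ∣ x n ∣ ≤ B)))
  bound x cx with cx 1ℚ (ℚₚ.positive⁻¹ 1ℚ)
  ... | N , hx = ∣ x N ∣ + 1ℚ
               , ℚₚ.+-mono-≤-< (ℚₚ.0≤∣p∣ (x N)) (ℚₚ.positive⁻¹ 1ℚ)
               , N , λ n n≥ → begin
        ∣ x n ∣                    ≡⟨ cong ∣_∣ (split-off (x n) (x N)) ⟩
        ∣ x N + (x n - x N) ∣      ≤⟨ ℚₚ.∣p+q∣≤∣p∣+∣q∣ (x N) (x n - x N) ⟩
        ∣ x N ∣ + ∣ x n - x N ∣    ≤⟨ ℚₚ.+-monoʳ-≤ ∣ x N ∣ (ℚₚ.<⇒≤ (hx n N n≥ ℕₚ.≤-refl)) ⟩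
        ∣ x N ∣ + 1ℚ               ∎
    where open ℚₚ.≤-Reasoning

  *-cauchy : ∀ x y → IsCauchy x → IsCauchy y → IsCauchy (λ n → x n * y n)
  *-cauchy x y cx cy ε 0<ε with bound x cx | bound y cy
  ... | B , 0<B , M , hB | C , 0<C , N , hC = K , λ m n m≥ n≥ → begin-strict
        ∣ x m * y m - x n * y n ∣
          ≡⟨ cong ∣_∣ (*-diff (x m) (y m) (x n) (y n)) ⟩
        ∣ x m * (y m - y n) + y n * (x m - x n) ∣
          ≤⟨ ℚₚ.∣p+q∣≤∣p∣+∣q∣ (x m * (y m - y n)) (y n * (x m - x n)) ⟩
        ∣ x m * (y m - y n) ∣ + ∣ y n * (x m - x n) ∣
          ≡⟨ cong₂ _+_ (ℚₚ.∣p*q∣≡∣p∣*∣q∣ (x m) (y m - y n)) (ℚₚ.∣p*q∣≡∣p∣*∣q∣ (y n) (x m - x n)) ⟩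
        ∣ x m ∣ * ∣ y m - y n ∣ + ∣ y n ∣ * ∣ x m - x n ∣
          ≤⟨ ℚₚ.+-mono-≤
               (ℚₚ.*-monoʳ-≤-nonNeg ∣ y m - y n ∣ {{ℚ.nonNegative (ℚₚ.0≤∣p∣ (y m - y n))}} (hB m (k₁ m≥)))
               (ℚₚ.*-monoʳ-≤-nonNeg ∣ x m - x n ∣ {{ℚ.nonNegative (ℚₚ.0≤∣p∣ (x m - x n))}} (hC n (k₂ n≥))) ⟩
        B * ∣ y m - y n ∣ + C * ∣ x m - x n ∣
          <⟨ ℚₚ.+-mono-<
               (ℚₚ.*-monoʳ-<-pos B {{positive 0<B}} (hy m n (k₄ m≥) (k₄ n≥)))
               (ℚₚ.*-monoʳ-<-pos C {{positive 0<C}} (hx m n (k₃ m≥) (k₃ n≥))) ⟩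
        B * η + C * η      ≡⟨ sym (ℚₚ.*-distribʳ-+ η B C) ⟩
        D * (D⁻¹ * ε)      ≡⟨ sym (ℚₚ.*-assoc D D⁻¹ ε) ⟩
        (D * D⁻¹) * ε      ≡⟨ cong (_* ε) (ℚₚ.*-inverseʳ D {{D≢0}}) ⟩
        1ℚ * ε             ≡⟨ ℚₚ.*-identityˡ ε ⟩
        ε                  ∎
    where
    open ℚₚ.≤-Reasoning
    D : ℚ
    D = B + C
    D>0 : ℚ.Positive D
    D>0 = positive (ℚₚ.+-mono-< 0<B 0<C)
    D≢0 : ℚ.NonZero D
    D≢0 = ℚₚ.pos⇒nonZero D {{D>0}}
    D⁻¹ : ℚ
    D⁻¹ = ℚ.1/_ D {{D≢0}}
    η : ℚ
    η = D⁻¹ * ε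
    0<η : 0ℚ < η
    0<η = subst (_< η) (ℚₚ.*-zeroʳ D⁻¹) (ℚₚ.*-monoʳ-<-pos D⁻¹ {{ℚₚ.1/pos⇒pos D {{D>0}}}} 0<ε)
    P Q K : ℕ
    P = proj₁ (cx η 0<η)
    Q = proj₁ (cy η 0<η)
    K = (M ℕ.⊔ N) ℕ.⊔ (P ℕ.⊔ Q)
    hx = proj₂ (cx η 0<η)
    hy = proj₂ (cy η 0<η)
    k₁ : ∀ {m} → K ℕ.≤ m → M ℕ.≤ m
    k₁ h = ℕₚ.m⊔n≤o⇒m≤o M N (ℕₚ.m⊔n≤o⇒m≤o (M ℕ.⊔ N) (P ℕ.⊔ Q) h)
    k₂ : ∀ {m} → K ℕ.≤ m → N ℕ.≤ m
    k₂ h = ℕₚ.m⊔n≤o⇒n≤o M N (ℕₚ.m⊔n≤o⇒m≤o (M ℕ.⊔ N) (P ℕ.⊔ Q) h)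
    k₃ : ∀ {m} → K ℕ.≤ m → P ℕ.≤ m
    k₃ h = ℕₚ.m⊔n≤o⇒m≤o P Q (ℕₚ.m⊔n≤o⇒n≤o (M ℕ.⊔ N) (P ℕ.⊔ Q) h)
    k₄ : ∀ {m} → K ℕ.≤ m → Q ℕ.≤ m
    k₄ h = ℕₚ.m⊔n≤o⇒n≤o P Q (ℕₚ.m⊔n≤o⇒n≤o (M ℕ.⊔ N) (P ℕ.⊔ Q) h)

infixl 6 _+ʳ_ _-ʳ_
infixl 7 _*ʳ_

fromℚ : ℚ → ℝ
fromℚ q = mkℝ (λ _ → q) λ ε 0<ε → 0 , λ _ _ _ _ →
  subst (_< ε) (sym (cong ∣_∣ (ℚₚ.+-inverseʳ q))) 0<ε

_+ʳ_ : ℝ → ℝ → ℝ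
x +ʳ y = mkℝ (λ n → seq x n + seq y n) (+-cauchy (seq x) (seq y) (cauchy x) (cauchy y))

-ʳ_ : ℝ → ℝ
-ʳ x = mkℝ (λ n → - seq x n) (neg-cauchy (seq x) (cauchy x))

_-ʳ_ : ℝ → ℝ → ℝ
x -ʳ y = x +ʳ (-ʳ y)

_*ʳ_ : ℝ → ℝ → ℝ
x *ʳ y = mkℝ (λ n → seq x n * seq y n) (*-cauchy (seq x) (seq y) (cauchy x) (cauchy y))

infix  8 _+i_
infix  4 _≈ᶜ_
infixl 6 _+ᶜ_ _-ᶜ_
infixl 7 _*ᶜ_

record ℂ : Set where
  constructor _+i_
  field
    re im : ℝ

open ℂ public

record _≈ᶜ_ (z w : ℂ) : Set where
  constructor mk≈ᶜ
  field
    re-≈ : re z ≈ʳ re w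
    im-≈ : im z ≈ʳ im w

open _≈ᶜ_ public

ℚ→ℂ : ℚ → ℂ
ℚ→ℂ q = fromℚ q +i fromℚ 0ℚ

ℕ→ℂ : ℕ → ℂ
ℕ→ℂ k = ℚ→ℂ (+ k ℚ./ 1)

0ᶜ 1ᶜ : ℂ
0ᶜ = ℚ→ℂ 0ℚ
1ᶜ = ℚ→ℂ 1ℚ

_+ᶜ_ : ℂ → ℂ → ℂ
z +ᶜ w = (re z +ʳ re w) +i (im z +ʳ im w)

-ᶜ_ : ℂ → ℂ
-ᶜ z = (-ʳ re z) +i (-ʳ im z)

_-ᶜ_ : ℂ → ℂ → ℂ
z -ᶜ w = z +ᶜ (-ᶜ w)

_*ᶜ_ : ℂ → ℂ → ℂ
z *ᶜ w = (re z *ʳ re w -ʳ im z *ʳ im w) +i (re z *ʳ im w +ʳ im z *ʳ re w)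

∣_∣² : ℂ → ℝ
∣ z ∣² = re z *ʳ re z +ʳ im z *ʳ im z

infix 4 _⟶ᶜ_

-- |z r - l| < ε is expressed by squaring both sides, as no square root is
-- available.
_⟶ᶜ_ : (ℕ → ℂ) → ℂ → Set
z ⟶ᶜ l = ∀ ε → 0ℚ < ε →
  Σ[ N ∈ ℕ ] (∀ r → N ℕ.≤ r → ∣ z r -ᶜ l ∣² <ʳ fromℚ (ε * ε))

-- Polynomials over ℂ are coefficient lists, constant term first.  Trailing
-- zeros are allowed, so polynomials are compared with _≈ᵖ_.

Poly : Set
Poly = List ℂ

infix  4 _≈ᵖ_
infixl 6 _+ᵖ_
infixl 7 _*ᵖ_ _•_
infixr 8 _^ᵖ_

coeff : Poly → ℕ → ℂ
coeff []      _       = 0ᶜ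
coeff (c ∷ p) zero    = c
coeff (c ∷ p) (suc i) = coeff p i

_≈ᵖ_ : Poly → Poly → Set
p ≈ᵖ q = ∀ i → coeff p i ≈ᶜ coeff q i

_+ᵖ_ : Poly → Poly → Poly
[]      +ᵖ q       = q
(c ∷ p) +ᵖ []      = c ∷ p
(c ∷ p) +ᵖ (d ∷ q) = (c +ᶜ d) ∷ (p +ᵖ q)

_•_ : ℂ → Poly → Poly
c • p = List.map (c *ᶜ_) p

_*ᵖ_ : Poly → Poly → Poly
[]      *ᵖ q = []
(c ∷ p) *ᵖ q = (c • q) +ᵖ (0ᶜ ∷ (p *ᵖ q))

_^ᵖ_ : Poly → ℕ → Poly
p ^ᵖ zero  = 1ᶜ ∷ []
p ^ᵖ suc n = p *ᵖ (p ^ᵖ n)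

eval : Poly → ℂ → ℂ
eval []      z = 0ᶜ
eval (c ∷ p) z = c +ᶜ z *ᶜ eval p z

1-x : Poly
1-x = 1ᶜ ∷ (-ᶜ 1ᶜ) ∷ []

-- Rational functions are fractions of polynomials, considered up to _≃_.

record ℛ : Set where
  constructor _/_⟨_⟩
  field
    num   : Poly
    den   : Poly
    den≢0 : ¬ (den ≈ᵖ [])

open ℛ public

infix 4 _≃_

_≃_ : ℛ → ℛ → Set
R ≃ S = num R *ᵖ den S ≈ᵖ num S *ᵖ den R

infixl 7 _/ℕ_

_/ℕ_ : ℛ → (k : ℕ) → .{{NonZero k}} → ℛ
R /ℕ k = (ℚ→ℂ (+ 1 ℚ./ k) • num R) / den R ⟨ den≢0 R ⟩

infix 4 _⟶_

-- Convergence of a sequence of rational functions: all members and the limit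
-- can be written over one common denominator, with numerators of bounded
-- degree whose coefficients converge.  This is convergence in a
-- finite-dimensional subspace of the space of rational functions; it implies
-- convergence of the values at every point where the common denominator is
-- invertible, and of the Laurent coefficients at 0.
_⟶_ : (ℕ → ℛ) → ℛ → Set
S ⟶ L =
  Σ[ q ∈ Poly ] Σ[ q≢0 ∈ ¬ (q ≈ᵖ []) ] Σ[ d ∈ ℕ ]
  Σ[ p ∈ (ℕ → Vec ℂ d) ] Σ[ l ∈ Vec ℂ d ]
    (∀ r → S r ≃ Vec.toList (p r) / q ⟨ q≢0 ⟩)
  × (L ≃ Vec.toList l / q ⟨ q≢0 ⟩)
  × (∀ i → (λ r → Vec.lookup (p r) i) ⟶ᶜ Vec.lookup l i)

private
  SameTerms : ℂ → ℂ → Set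
  SameTerms z w = ∀ m → (seq (re z) m ≡ seq (re w) m) × (seq (im z) m ≡ seq (im w) m)

  constant-term-step : ∀ q → SameTerms (coeff (1-x *ᵖ q) 0) (coeff q 0)
  constant-term-step []      m = refl , refl
  constant-term-step (d ∷ q) m = eq-re (seq (re d) m) (seq (im d) m)
                               , eq-im (seq (re d) m) (seq (im d) m)
    where
    eq-re : ∀ u v → (1ℚ * u + - (0ℚ * v)) + 0ℚ ≡ u
    eq-re u v = trans (ℚₚ.+-identityʳ _) (trans (cong₂ (λ s t → s + - t) (ℚₚ.*-identityˡ u) (ℚₚ.*-zeroˡ v)) (ℚₚ.+-identityʳ u))
    eq-im : ∀ u v → (1ℚ * v + 0ℚ * u) + 0ℚ ≡ v
    eq-im u v = trans (ℚₚ.+-identityʳ _) (trans (cong₂ _+_ (ℚₚ.*-identityˡ v) (ℚₚ.*-zeroˡ u)) (ℚₚ.+-identityʳ v))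

  constant-term : ∀ n → SameTerms (coeff (1-x ^ᵖ n) 0) 1ᶜ
  constant-term zero    m = refl , refl
  constant-term (suc n) m =
      trans (proj₁ (constant-term-step (1-x ^ᵖ n) m)) (proj₁ (constant-term n m))
    , trans (proj₂ (constant-term-step (1-x ^ᵖ n) m)) (proj₂ (constant-term n m))

[1-x]^_≢0 : ∀ n → ¬ (1-x ^ᵖ n ≈ᵖ [])
[1-x]^ n ≢0 h = ℚₚ.<-irrefl {1ℚ} refl
  (subst (λ t → ∣ t - 0ℚ ∣ < 1ℚ) (proj₁ (constant-term n N)) (proj₂ near N ℕₚ.≤-refl))
  where
  near = close (re-≈ (h 0)) 1ℚ (ℚₚ.positive⁻¹ 1ℚ)
  N = proj₁ near

infix 7 _/[1-x]^_

_/[1-x]^_ : Poly → ℕ → ℛ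
p /[1-x]^ n = p / 1-x ^ᵖ n ⟨ [1-x]^ n ≢0 ⟩

Series : Set
Series = ℤ → ℂ

infixl 7 _·_

_·_ : Poly → Series → Series
([]      · a) n = 0ᶜ
((c ∷ p) · a) n = c *ᶜ a n +ᶜ (p · a) (n ℤ.- + 1)

coeffℤ : Poly → Series
coeffℤ p (+ n)    = coeff p n
coeffℤ p -[1+ n ] = 0ᶜ

BoundedBelow : Series → Set
BoundedBelow a = Σ[ N ∈ ℤ ] (∀ n → n ℤ.< N → a n ≈ᶜ 0ᶜ)

-- a is the sequence of Laurent coefficients of R at 0, i.e. den R · a = num R
-- among Laurent series with finitely many negative terms; since these form a
-- domain, a is determined by R up to _≈ᶜ_, and R by a up to _≃_.
-- A relation rather than a function, because locating the lowest nonzero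
-- coefficient of den R is not computable.
_HasExpansion_ : ℛ → Series → Set
R HasExpansion a = BoundedBelow a × (∀ n → (den R · a) n ≈ᶜ coeffℤ (num R) n)

Φ : ℕ → Series → Series
Φ b a n = a (+ b ℤ.* n ℤ.+ (+ b ℤ.- + 1))

Φ^ : ℕ → ℕ → Series → Series
Φ^ b zero    a = a
Φ^ b (suc r) a = Φ b (Φ^ b r a)

-- S represents the r-th iterate of Φ b at R, where Φ b acts on rational
-- functions through their Laurent coefficients.
IsΦ^ : (b r : ℕ) → ℛ → ℛ → Set
IsΦ^ b r R S = Σ[ a ∈ Series ] (R HasExpansion a × S HasExpansion Φ^ b r a)

words : (A : Set) → List A → (k : ℕ) → List (Vec A k)
words A alphabet zero    = [] ∷ []
words A alphabet (suc k) = List.cartesianProductWith _∷_ alphabet (words A alphabet k)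

unique? : ∀ {m k} (w : Vec (Fin m) k) → Dec (Unique w)
unique? = allPairs? (λ i j → ¬? (i Finₚ.≟ j))

-- One-line notation with letters 0, …, m - 1: the words of length m without
-- repetition.
permutations : (m : ℕ) → List (Vec (Fin m) m)
permutations m = List.filter unique? (words (Fin m) (List.allFin m) m)

descents : ∀ {m k} → Vec (Fin m) k → ℕ
descents []          = 0
descents (i ∷ [])    = 0
descents (i ∷ j ∷ w) = (if does (j Finₚ.<? i) then 1 else 0) ℕ.+ descents (j ∷ w)

eulerian : ℕ → ℕ → ℕ
eulerian m k = List.length (List.filter (λ w → descents w ℕₚ.≟ k) (permutations m))

eulerianPoly : ℕ → Poly
eulerianPoly m = List.map (λ k → ℕ→ℂ (eulerian m k)) (List.upTo m)

b^m≢0 : ∀ b m .{{_ : NonTrivial b}} → NonZero (b ℕ.^ m)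
b^m≢0 b m = ℕₚ.m^n≢0 b m {{ℕ.nonTrivial⇒nonZero b}}

{-# OPTIONS --safe #-}
-- Put m = n - 1 and index the expansion of h / (1 - x)^n by t = k + 1: its coefficients are
-- G t = Σ_l h_l C(t - 1 - l + m, m), a polynomial in t of degree at most m with G 0 = 0, and
-- Φ_b^r replaces G t by G (b^r t). Multiplying back by (1 - x)^n, i.e. taking m + 1 backward
-- differences, gives a numerator of degree < m, since the differences of a polynomial of degree m
-- vanish. As G (b^r t) / b^(r m) tends to h(1) t^m / m! with error O(b^-r), the numerator tends
-- to h(1) / m! times (1 - x)^(m + 1) Σ (k + 1)^m x^k, and the latter is A_m. This last identity is
-- refined to words starting with a letter i: removing the first letter gives a recursion that is
-- also satisfied by (1 - x)^(m + 1) Σ t^i (t + 1)^(m - i) x^t.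
module Submission where

open import Defs
open import Data.Nat.Base as ℕ using (ℕ; zero; suc; s≤s; z≤n; _!)
import Data.Nat.Properties as ℕₚ
open import Data.Nat.GeneralisedArithmetic using (fold)
open import Data.Integer.Base as ℤ using (ℤ; -[1+_])
import Data.Integer.Properties as ℤₚ
import Data.Integer.Tactic.RingSolver as ℤ-RingSolver
open import Data.Bool.Base using (Bool; true; false; if_then_else_; _∧_; not)
open import Data.Fin.Base using (Fin; zero; suc; toℕ; punchIn)
import Data.Fin.Properties as Finₚ
open import Data.List.Base as List
  using (List; []; _∷_; _++_; filter; length; concatMap; allFin; cartesianProductWith; applyUpTo; upTo)
import Data.List.Properties as Listₚ
open import Data.Vec.Base as Vec using (Vec; []; _∷_; toList; lookup; tabulate)
import Data.Vec.Properties as Vecₚ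
import Data.Vec.Relation.Unary.All as All
open import Data.Product.Base using (Σ-syntax; _×_; _,_; proj₁; proj₂)
open import Data.Sum.Base using (inj₁; inj₂)
import Data.Rational.Base as ℚ
import Data.Rational.Properties as ℚₚ
import Data.Rational.Unnormalised.Base as ℚᵘ
import Data.Rational.Unnormalised.Properties as ℚᵘₚ
open import Algebra.Bundles using (CommutativeRing)
open import Function.Base using (_∘_)
open import Function.Bundles using (mk⇔)
open import Level using (Level)
open import Relation.Unary using (Pred; Decidable)
open import Relation.Nullary using (Dec; yes; no; ¬_)
open import Relation.Nullary.Decidable using (does; does-⇔; ¬?; dec⇒maybe)
open import Relation.Binary.PropositionalEquality hiding ([_])
open import Tactic.RingSolver using (solve-∀)
open import Tactic.RingSolver.Core.AlmostCommutativeRing using (AlmostCommutativeRing; fromCommutativeRing)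

-- The coefficients of h are complex numbers given by Cauchy sequences, whereas all other data are
-- rational. Every coefficient that occurs is therefore kept as a linear form in h with rational
-- weights, one for each monomial x^l. Identities and estimates are proved in ℚ for a fixed l; the
-- h_l return only at the end, one approximation index at a time, and then only their boundedness
-- matters. In the limit the weight no longer depends on l, and so h enters the result only through
-- the sum of its coefficients, h(1). The bound on the degree of h is what gives G 0 = 0: for l < m
-- the number -l is a root of the binomial polynomial of degree m. Without this zero the value
-- missing at k = -1 would disturb the first difference. The count of descents alone obeys no
-- recursion under removal of the first letter, because whether a descent is lost depends on the
-- letter that follows. This forces the refinement by first letters.

module Lemmas where

  open ℚ hiding (_/_; floor; _≃_)
  open import Algebra.Definitions.RawSemiring ℚ.+-*-rawSemiring using (_^_; sum)
  open import Algebra.Properties.Monoid.Sum (CommutativeRing.+-monoid ℚₚ.+-*-commutativeRing) using (sum-cong-≋)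

  -- Rational arithmetic and difference operators

  ring : AlmostCommutativeRing _ _
  ring = fromCommutativeRing ℚₚ.+-*-commutativeRing (λ x → dec⇒maybe (0ℚ ℚₚ.≟ x))

  ι : ℕ → ℚ
  ι k = ℤ.+ k ℚ./ 1

  recip : (k : ℕ) .{{_ : ℕ.NonZero k}} → ℚ
  recip k = ℤ.+ 1 ℚ./ k

  ι≃ : ∀ k → toℚᵘ (ι k) ℚᵘ.≃ (ℤ.+ k ℚᵘ./ 1)
  ι≃ k = ℚₚ.toℚᵘ-fromℚᵘ (ℤ.+ k ℚᵘ./ 1)

  ι-+ : ∀ j k → ι (j ℕ.+ k) ≡ ι j + ι k
  ι-+ j k = ℚₚ.toℚᵘ-injective (begin
    toℚᵘ (ι (j ℕ.+ k)) ≈⟨ ι≃ (j ℕ.+ k) ⟩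
    ℤ.+ (j ℕ.+ k) ℚᵘ./ 1 ≈⟨ ℚᵘ.*≡* (cong (ℤ._* ℤ.+ 1) (trans (ℤₚ.pos-+ j k)
                               (sym (cong₂ ℤ._+_ (ℤₚ.*-identityʳ (ℤ.+ j)) (ℤₚ.*-identityʳ (ℤ.+ k)))))) ⟩
    (ℤ.+ j ℚᵘ./ 1) ℚᵘ.+ (ℤ.+ k ℚᵘ./ 1) ≈⟨ ℚᵘₚ.≃-sym (ℚᵘₚ.+-cong (ι≃ j) (ι≃ k)) ⟩
    toℚᵘ (ι j) ℚᵘ.+ toℚᵘ (ι k) ≈⟨ ℚᵘₚ.≃-sym (ℚₚ.toℚᵘ-homo-+ (ι j) (ι k)) ⟩
    toℚᵘ (ι j + ι k) ∎)
    where open ℚᵘₚ.≃-Reasoning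

  ι-suc : ∀ k → ι (suc k) ≡ 1ℚ + ι k
  ι-suc = ι-+ 1

  ι-* : ∀ j k → ι (j ℕ.* k) ≡ ι j * ι k
  ι-* zero    k = sym (ℚₚ.*-zeroˡ (ι k))
  ι-* (suc j) k = begin
    ι (k ℕ.+ j ℕ.* k)     ≡⟨ ι-+ k (j ℕ.* k) ⟩
    ι k + ι (j ℕ.* k)     ≡⟨ cong (ι k +_) (ι-* j k) ⟩
    ι k + ι j * ι k       ≡⟨ factor (ι k) (ι j) ⟩
    (1ℚ + ι j) * ι k      ≡⟨ cong (_* ι k) (ι-suc j) ⟨
    ι (suc j) * ι k       ∎
    where
    open ≡-Reasoning
    factor : ∀ x y → x + y * x ≡ (1ℚ + y) * x
    factor = solve-∀ ring

  ι-recip : ∀ k .{{_ : ℕ.NonZero k}} → ι k * recip k ≡ 1ℚ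
  ι-recip k@(suc k-1) = ℚₚ.toℚᵘ-injective (begin
    toℚᵘ (ι k * recip k) ≈⟨ ℚₚ.toℚᵘ-homo-* (ι k) (recip k) ⟩
    toℚᵘ (ι k) ℚᵘ.* toℚᵘ (recip k) ≈⟨ ℚᵘₚ.*-cong (ι≃ k) (ℚₚ.toℚᵘ-fromℚᵘ (ℤ.+ 1 ℚᵘ./ k)) ⟩
    (ℤ.+ k ℚᵘ./ 1) ℚᵘ.* (ℤ.+ 1 ℚᵘ./ k) ≈⟨ ℚᵘ.*≡* (cong ℤ.+_ (trans (ℕₚ.*-identityʳ _)
                                        (trans (ℕₚ.*-identityʳ k) (sym (trans (ℕₚ.+-identityʳ (k ℕ.+ 0)) (ℕₚ.+-identityʳ k)))))) ⟩
    toℚᵘ 1ℚ ∎)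
    where open ℚᵘₚ.≃-Reasoning

  recip-* : ∀ j k .{{_ : ℕ.NonZero j}} .{{_ : ℕ.NonZero k}} .{{_ : ℕ.NonZero (j ℕ.* k)}} →
    recip (j ℕ.* k) ≡ recip j * recip k
  recip-* j k = begin
    recip (j ℕ.* k)
      ≡⟨ unit₁ (recip (j ℕ.* k)) (ι j) (recip j) (ι k) (recip k) (ι-recip j) (ι-recip k) ⟩
    (ι j * ι k) * recip (j ℕ.* k) * (recip j * recip k)
      ≡⟨ cong (λ x → x * recip (j ℕ.* k) * (recip j * recip k)) (ι-* j k) ⟨
    ι (j ℕ.* k) * recip (j ℕ.* k) * (recip j * recip k)
      ≡⟨ cong (_* (recip j * recip k)) (ι-recip (j ℕ.* k)) ⟩
    1ℚ * (recip j * recip k)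
      ≡⟨ ℚₚ.*-identityˡ _ ⟩
    recip j * recip k ∎
    where
    open ≡-Reasoning
    regroup : ∀ x a b c d → (a * b) * (c * d) * x ≡ (a * c) * x * (b * d)
    regroup = solve-∀ ring
    unit₁ : ∀ x a b c d → a * b ≡ 1ℚ → c * d ≡ 1ℚ → x ≡ (a * c) * x * (b * d)
    unit₁ x a b c d ab cd = trans (sym (ℚₚ.*-identityˡ x))
      (trans (cong (_* x) (sym (cong₂ _*_ ab cd))) (regroup x a b c d))

  -- Multiplication of the generating function by 1 - x, i.e. the backward difference with s (-1) = 0.
  D : (ℕ → ℚ) → ℕ → ℚ
  D s zero    = s zero
  D s (suc k) = s (suc k) - s k

  D^ : ℕ → (ℕ → ℚ) → ℕ → ℚ
  D^ n s = fold s D n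

  D-cong : ∀ {s t} → s ≗ t → D s ≗ D t
  D-cong e zero    = e zero
  D-cong e (suc k) = cong₂ _-_ (e (suc k)) (e k)

  D^-cong : ∀ n {s t} → s ≗ t → D^ n s ≗ D^ n t
  D^-cong zero    e = e
  D^-cong (suc n) e = D-cong (D^-cong n e)

  D^-comm : ∀ n s → D^ n (D s) ≡ D^ (suc n) s
  D^-comm zero    s = refl
  D^-comm (suc n) s = cong D (D^-comm n s)

  D-linear : ∀ α s β t → D (λ k → α * s k + β * t k) ≗ λ k → α * D s k + β * D t k
  D-linear α s β t zero    = refl
  D-linear α s β t (suc k) = lin α (s (suc k)) (s k) β (t (suc k)) (t k)
    where
    lin : ∀ α a a′ β b b′ → (α * a + β * b) - (α * a′ + β * b′) ≡ α * (a - a′) + β * (b - b′)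
    lin = solve-∀ ring

  D^-linear : ∀ n α s β t → D^ n (λ k → α * s k + β * t k) ≗ λ k → α * D^ n s k + β * D^ n t k
  D^-linear zero    α s β t k = refl
  D^-linear (suc n) α s β t k =
    trans (D-cong (D^-linear n α s β t) k) (D-linear α (D^ n s) β (D^ n t) k)

  -- On generating functions this is multiplication by x, hence it commutes with `D`.
  X : (ℕ → ℚ) → ℕ → ℚ
  X s zero    = 0ℚ
  X s (suc k) = s k

  X-cong : ∀ {s t} → s ≗ t → X s ≗ X t
  X-cong e zero    = refl
  X-cong e (suc k) = e k

  D-X : ∀ s → D (X s) ≗ X (D s)
  D-X s zero          = refl
  D-X s (suc zero)    = ℚₚ.+-identityʳ (s 0)
  D-X s (suc (suc k)) = refl

  D^-X : ∀ n s → D^ n (X s) ≗ X (D^ n s)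
  D^-X zero    s k = refl
  D^-X (suc n) s k = trans (D-cong (D^-X n s) k) (D-X (D^ n s) k)

  -- The coefficients of x^d. The test is `≡ᵇ` because `does (d ≟ k)` evaluates to it, so that
  -- filtered counts and sums of `mono` branch on the same boolean.
  mono : ℕ → ℕ → ℚ
  mono d k = if d ℕ.≡ᵇ k then 1ℚ else 0ℚ

  X-mono : ∀ d → X (mono d) ≗ mono (suc d)
  X-mono d zero    = refl
  X-mono d (suc k) = refl

  -- Forward differences and polynomial sequences

  Δ : (ℕ → ℚ) → ℕ → ℚ
  Δ s k = s (suc k) - s k

  -- The convention s (-1) = 0 reaches only the first `d` entries; beyond them backward and forward
  -- differences agree up to a shift.
  D^-tail : ∀ d s i → D^ d s (d ℕ.+ i) ≡ fold s Δ d i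
  D^-tail zero    s i = refl
  D^-tail (suc d) s i = cong₂ _-_
    (trans (cong (D^ d s) (sym (ℕₚ.+-suc d i))) (D^-tail d s (suc i))) (D^-tail d s i)

  -- Over ℚ, the sequences killed by `d` forward differences are the polynomials of degree less than
  -- `d`. This form bounds degrees without exhibiting coefficients.
  Deg< : ℕ → (ℕ → ℚ) → Set
  Deg< zero    s = ∀ k → s k ≡ 0ℚ
  Deg< (suc d) s = Deg< d (Δ s)

  Deg<⇒Δ^≡0 : ∀ d s → Deg< d s → ∀ k → fold s Δ d k ≡ 0ℚ
  Deg<⇒Δ^≡0 zero    s z k = z k
  Deg<⇒Δ^≡0 (suc d) s z k = trans (cong (λ t → t k) (comm d s)) (Deg<⇒Δ^≡0 d (Δ s) z k)
    where
    comm : ∀ d s → fold s Δ (suc d) ≡ fold (Δ s) Δ d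
    comm zero    s = refl
    comm (suc d) s = cong Δ (comm d s)

  Deg<-cong : ∀ d {s t} → s ≗ t → Deg< d s → Deg< d t
  Deg<-cong zero    e z k = trans (sym (e k)) (z k)
  Deg<-cong (suc d) e z = Deg<-cong d (λ k → cong₂ _-_ (e (suc k)) (e k)) z

  Deg<-suc : ∀ d {s} → Deg< d s → Deg< (suc d) s
  Deg<-suc zero    z k = cong₂ _-_ (z (suc k)) (z k)
  Deg<-suc (suc d) z = Deg<-suc d z

  Deg<-linear : ∀ d α s β t → Deg< d s → Deg< d t → Deg< d (λ k → α * s k + β * t k)
  Deg<-linear zero α s β t zs zt k =
    trans (cong₂ (λ x y → α * x + β * y) (zs k) (zt k)) (zeros α β)
    where
    zeros : ∀ α β → α * 0ℚ + β * 0ℚ ≡ 0ℚ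
    zeros = solve-∀ ring
  Deg<-linear (suc d) α s β t zs zt = Deg<-cong d
    (λ k → lin α (s (suc k)) (s k) β (t (suc k)) (t k)) (Deg<-linear d α (Δ s) β (Δ t) zs zt)
    where
    lin : ∀ α a a′ β b b′ → α * (a - a′) + β * (b - b′) ≡ (α * a + β * b) - (α * a′ + β * b′)
    lin = solve-∀ ring

  -- Discrete Leibniz rule: for u k = α k + β, the difference of u s at k is u (k + 1) Δ s k + α s
  -- k. Since u (k + 1) = α k + (α + β), the induction needs an arbitrary constant term.
  Deg<-affine : ∀ d α β {s} → Deg< d s → Deg< (suc d) (λ k → (α * ι k + β) * s k)
  Deg<-affine zero α β {s} z k =
    trans (cong₂ (λ x y → (α * ι (suc k) + β) * x - (α * ι k + β) * y) (z (suc k)) (z k))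
          (zeros (α * ι (suc k) + β) (α * ι k + β))
    where
    zeros : ∀ x y → x * 0ℚ - y * 0ℚ ≡ 0ℚ
    zeros = solve-∀ ring
  Deg<-affine (suc d) α β {s} z = Deg<-cong (suc d) leibniz
    (Deg<-linear (suc d) 1ℚ (λ k → (α * ι k + (α + β)) * Δ s k) α s (Deg<-affine d α (α + β) z) z)
    where
    rearrange : ∀ α β x a a′ →
      1ℚ * ((α * x + (α + β)) * (a - a′)) + α * a′ ≡ (α * (1ℚ + x) + β) * a - (α * x + β) * a′
    rearrange = solve-∀ ring
    leibniz : ∀ k → 1ℚ * ((α * ι k + (α + β)) * Δ s k) + α * s k
                  ≡ Δ (λ k → (α * ι k + β) * s k) k
    leibniz k = trans (rearrange α β (ι k) (s (suc k)) (s k))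
      (cong (λ x → (α * x + β) * s (suc k) - (α * ι k + β) * s k) (sym (ι-suc k)))

  -- Binomial coefficients as polynomials

  -- binom j y = y (y + 1) ⋯ (y + j - 1) / j!, the polynomial continuing C(y + j - 1, j).
  binom : ℕ → ℚ → ℚ
  binom zero    y = 1ℚ
  binom (suc j) y = (y + ι j) * recip (suc j) * binom j y

  -- Lowering the argument adds the factor y - 1 at the bottom of the product, while the recursion
  -- of `binom` splits off the top one.
  binom-pred : ∀ j y → binom (suc j) (y - 1ℚ) ≡ (y - 1ℚ) * recip (suc j) * binom j y
  binom-pred zero    y = base y
    where
    base : ∀ y → (y - 1ℚ + 0ℚ) * 1ℚ * 1ℚ ≡ (y - 1ℚ) * 1ℚ * 1ℚ
    base = solve-∀ ring
  binom-pred (suc j) y = begin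
    (y - 1ℚ + ι (suc j)) * r₁ * binom (suc j) (y - 1ℚ)
      ≡⟨ cong₂ (λ x z → (y - 1ℚ + x) * r₁ * z) (ι-suc j) (binom-pred j y) ⟩
    (y - 1ℚ + (1ℚ + ι j)) * r₁ * ((y - 1ℚ) * r₀ * binom j y)
      ≡⟨ rearrange y (ι j) r₁ r₀ (binom j y) ⟩
    (y - 1ℚ) * r₁ * ((y + ι j) * r₀ * binom j y) ∎
    where
    open ≡-Reasoning
    r₀ = recip (suc j)
    r₁ = recip (suc (suc j))
    rearrange : ∀ y x r s p →
      (y - 1ℚ + (1ℚ + x)) * r * ((y - 1ℚ) * s * p) ≡ (y - 1ℚ) * r * ((y + x) * s * p)
    rearrange = solve-∀ ring

  -- Pascal's rule at an arbitrary rational argument: the two terms share all factors except y + j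
  -- and y - 1, which differ by j + 1.
  binom-difference : ∀ j y → binom (suc j) y - binom (suc j) (y - 1ℚ) ≡ binom j y
  binom-difference j y = begin
    (y + ι j) * r * p - binom (suc j) (y - 1ℚ)  ≡⟨ cong (λ z → (y + ι j) * r * p - z) (binom-pred j y) ⟩
    (y + ι j) * r * p - (y - 1ℚ) * r * p        ≡⟨ rearrange y (ι j) r p ⟩
    (1ℚ + ι j) * r * p                          ≡⟨ cong (λ z → z * r * p) (ι-suc j) ⟨
    ι (suc j) * r * p                           ≡⟨ cong (_* p) (ι-recip (suc j)) ⟩
    1ℚ * p                                      ≡⟨ ℚₚ.*-identityˡ p ⟩
    p                                           ∎
    where
    open ≡-Reasoning
    r = recip (suc j)
    p = binom j y
    rearrange : ∀ y x r p → (y + x) * r * p - (y - 1ℚ) * r * p ≡ (1ℚ + x) * r * p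
    rearrange = solve-∀ ring

  -- Either the last factor vanishes or an earlier one does. These roots stand in for the missing
  -- terms at the lower end of a series.
  binom-root : ∀ j l → l ℕ.< j → binom j (- ι l) ≡ 0ℚ
  binom-root (suc j) l (s≤s l≤j) with ℕₚ.m≤n⇒m<n∨m≡n l≤j
  ... | inj₁ l<j  = trans (cong ((- ι l + ι j) * recip (suc j) *_) (binom-root j l l<j))
    (ℚₚ.*-zeroʳ ((- ι l + ι j) * recip (suc j)))
  ... | inj₂ refl = zero-factor (ι j) (recip (suc j)) (binom j (- ι j))
    where
    zero-factor : ∀ x r p → (- x + x) * r * p ≡ 0ℚ
    zero-factor = solve-∀ ring

  -- Pascal's rule; at k = 0 there is no preceding term, and the root of `binom (suc j)` at 0
  -- replaces it.
  D-binom : ∀ j → D (λ k → binom (suc j) (ι (suc k))) ≗ λ k → binom j (ι (suc k))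
  D-binom j zero = begin
    binom (suc j) 1ℚ                     ≡⟨ ℚₚ.+-identityʳ _ ⟨
    binom (suc j) 1ℚ - 0ℚ                ≡⟨ cong (λ z → binom (suc j) 1ℚ - z) (binom-root (suc j) 0 (s≤s z≤n)) ⟨
    binom (suc j) 1ℚ - binom (suc j) 0ℚ  ≡⟨ binom-difference j 1ℚ ⟩
    binom j 1ℚ                           ∎
    where open ≡-Reasoning
  D-binom j (suc k) = begin
    binom (suc j) (ι (2 ℕ.+ k)) - binom (suc j) (ι (suc k))
      ≡⟨ cong (λ z → binom (suc j) (ι (2 ℕ.+ k)) - binom (suc j) z)
           (trans (cancel (ι (suc k))) (cong (_- 1ℚ) (sym (ι-suc (suc k))))) ⟩
    binom (suc j) (ι (2 ℕ.+ k)) - binom (suc j) (ι (2 ℕ.+ k) - 1ℚ)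
      ≡⟨ binom-difference j (ι (2 ℕ.+ k)) ⟩
    binom j (ι (2 ℕ.+ k)) ∎
    where
    open ≡-Reasoning
    cancel : ∀ x → x ≡ (1ℚ + x) - 1ℚ
    cancel = solve-∀ ring

  D^-binom-ι : ∀ m → D^ (suc m) (λ k → binom m (ι (suc k))) ≗ mono 0
  D^-binom-ι zero    zero    = refl
  D^-binom-ι zero    (suc k) = refl
  D^-binom-ι (suc m) k = begin
    D^ (suc (suc m)) (λ k → binom (suc m) (ι (suc k))) k
      ≡⟨ cong (λ s → s k) (D^-comm (suc m) _) ⟨
    D^ (suc m) (D (λ k → binom (suc m) (ι (suc k)))) k
      ≡⟨ D^-cong (suc m) (D-binom m) k ⟩
    D^ (suc m) (λ k → binom m (ι (suc k))) k
      ≡⟨ D^-binom-ι m k ⟩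
    mono 0 k ∎
    where open ≡-Reasoning

  -- x^l / (1 - x)^(m + 1) has the coefficients binom m (k + 1 - l), k ≥ 0.
  D^-binom : ∀ m l → l ℕ.≤ m → D^ (suc m) (λ k → binom m (ι (suc k) - ι l)) ≗ mono l
  D^-binom m zero    l≤m k = trans
    (D^-cong (suc m) (λ k → cong (binom m) (ℚₚ.+-identityʳ (ι (suc k)))) k) (D^-binom-ι m k)
  D^-binom m (suc l) l<m k = begin
    D^ (suc m) (λ k → binom m (ι (suc k) - ι (suc l))) k  ≡⟨ D^-cong (suc m) shift k ⟩
    D^ (suc m) (X (λ k → binom m (ι (suc k) - ι l))) k    ≡⟨ D^-X (suc m) _ k ⟩
    X (D^ (suc m) (λ k → binom m (ι (suc k) - ι l))) k    ≡⟨ X-cong (D^-binom m l (ℕₚ.<⇒≤ l<m)) k ⟩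
    X (mono l) k                                          ≡⟨ X-mono l k ⟩
    mono (suc l) k                                        ∎
    where
    open ≡-Reasoning
    cancel : ∀ x y → (1ℚ + x) - (1ℚ + y) ≡ x - y
    cancel = solve-∀ ring
    suc-suc : ∀ k → ι (suc k) - ι (suc l) ≡ ι k - ι l
    suc-suc k = trans (cong₂ _-_ (ι-suc k) (ι-suc l)) (cancel (ι k) (ι l))
    shift : (λ k → binom m (ι (suc k) - ι (suc l))) ≗ X (λ k → binom m (ι (suc k) - ι l))
    -- The shifted series starts with 0, and the polynomial must take this value too: its argument
    -- is -l, a root because l < m.
    shift zero    = trans (cong (binom m) (trans (suc-suc 0) (ℚₚ.+-identityˡ _))) (binom-root m l l<m)
    shift (suc k) = cong (binom m) (suc-suc (suc k))

  Deg<-binom : ∀ m B l → Deg< (suc m) (λ t → binom m (ι (B ℕ.* t) - ι l))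
  Deg<-binom zero    B l k = refl
  Deg<-binom (suc m) B l = Deg<-cong (suc (suc m))
    (λ t → cong (_* binom m (ι (B ℕ.* t) - ι l))
      (trans (rearrange (ι B) (ι t) (ι l) (ι m) (recip (suc m)))
             (cong (λ z → (z - ι l + ι m) * recip (suc m)) (sym (ι-* B t)))))
    (Deg<-affine (suc m) (ι B * recip (suc m)) ((ι m - ι l) * recip (suc m)) (Deg<-binom m B l))
    where
    rearrange : ∀ b t l m r → b * r * t + (m - l) * r ≡ (b * t - l + m) * r
    rearrange = solve-∀ ring

  -- The zero of binom m at - l (t = 0) makes the first difference an honest one at k = 0 as well.
  D^-dilated-binom-vanishes : ∀ m B l → l ℕ.< m → ∀ i → m ℕ.≤ i →
    D^ (suc m) (λ k → binom m (ι (B ℕ.* suc k) - ι l)) i ≡ 0ℚ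
  D^-dilated-binom-vanishes m B l l<m i m≤i = begin
    D^ (suc m) (λ k → F (suc k)) i     ≡⟨ cong (λ s → s i) (D^-comm m (λ k → F (suc k))) ⟨
    D^ m (D (λ k → F (suc k))) i       ≡⟨ D^-cong m first-difference i ⟩
    D^ m (Δ F) i                       ≡⟨ cong (D^ m (Δ F)) (ℕₚ.m+[n∸m]≡n m≤i) ⟨
    D^ m (Δ F) (m ℕ.+ (i ℕ.∸ m))       ≡⟨ D^-tail m (Δ F) (i ℕ.∸ m) ⟩
    -- `Deg< (suc m) F` unfolds to `Deg< m (Δ F)`: one of the m + 1 differences is already spent on
    -- `Δ F`.
    fold (Δ F) Δ m (i ℕ.∸ m)           ≡⟨ Deg<⇒Δ^≡0 m (Δ F) (Deg<-binom m B l) (i ℕ.∸ m) ⟩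
    0ℚ                                 ∎
    where
    open ≡-Reasoning
    F : ℕ → ℚ
    F t = binom m (ι (B ℕ.* t) - ι l)
    F0≡0 : F 0 ≡ 0ℚ
    F0≡0 = trans (cong (λ z → binom m (ι z - ι l)) (ℕₚ.*-zeroʳ B))
      (trans (cong (binom m) (ℚₚ.+-identityˡ (- ι l))) (binom-root m l l<m))
    first-difference : D (λ k → F (suc k)) ≗ Δ F
    first-difference zero    = trans (sym (ℚₚ.+-identityʳ (F 1))) (cong (λ z → F 1 - z) (sym F0≡0))
    first-difference (suc k) = refl

  -- Asymptotics

  recip-cong : ∀ {j k} .{{_ : ℕ.NonZero j}} .{{_ : ℕ.NonZero k}} → j ≡ k → recip j ≡ recip k
  recip-cong refl = refl

  recip≥0 : ∀ k .{{_ : ℕ.NonZero k}} → 0ℚ ≤ recip k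
  recip≥0 k = ℚₚ.nonNegative⁻¹ (recip k) {{ℚₚ.normalize-nonNeg 1 k}}

  ι-mono-≤ : ∀ {j k} → j ℕ.≤ k → ι j ≤ ι k
  ι-mono-≤ {j} {k} j≤k = begin
    ι j                  ≡⟨ ℚₚ.+-identityʳ (ι j) ⟨
    ι j + 0ℚ             ≤⟨ ℚₚ.+-monoʳ-≤ (ι j) (ℚₚ.nonNegative⁻¹ (ι (k ℕ.∸ j)) {{ℚₚ.normalize-nonNeg (k ℕ.∸ j) 1}}) ⟩
    ι j + ι (k ℕ.∸ j)    ≡⟨ ι-+ j (k ℕ.∸ j) ⟨
    ι (j ℕ.+ (k ℕ.∸ j))  ≡⟨ cong ι (ℕₚ.m+[n∸m]≡n j≤k) ⟩
    ι k                  ∎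
    where open ℚₚ.≤-Reasoning

  module BigO (δ : ℕ → ℚ) (0≤δ : ∀ r → 0ℚ ≤ δ r) (δ≤1 : ∀ r → δ r ≤ 1ℚ) where

    -- The bound holds for every r and not just eventually, so constants combine without any
    -- comparison of thresholds.
    O : (ℕ → ℚ) → Set
    O e = Σ[ K ∈ ℚ ] (0ℚ ≤ K × (∀ r → ∣ e r ∣ ≤ K * δ r))

    O-cong : ∀ {e f} → e ≗ f → O e → O f
    O-cong e≗f (K , 0≤K , h) = K , 0≤K , λ r → subst (λ x → ∣ x ∣ ≤ K * δ r) (e≗f r) (h r)

    O-linear : ∀ α {e} β {f} → O e → O f → O (λ r → α * e r + β * f r)
    O-linear α {e} β {f} (K , 0≤K , he) (L , 0≤L , hf) =
      ∣ α ∣ * K + ∣ β ∣ * L , ℚₚ.+-mono-≤ (nonneg α 0≤K) (nonneg β 0≤L) , λ r → begin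
        ∣ α * e r + β * f r ∣                    ≤⟨ ℚₚ.∣p+q∣≤∣p∣+∣q∣ (α * e r) (β * f r) ⟩
        ∣ α * e r ∣ + ∣ β * f r ∣                ≡⟨ cong₂ _+_ (ℚₚ.∣p*q∣≡∣p∣*∣q∣ α (e r)) (ℚₚ.∣p*q∣≡∣p∣*∣q∣ β (f r)) ⟩
        ∣ α ∣ * ∣ e r ∣ + ∣ β ∣ * ∣ f r ∣        ≤⟨ ℚₚ.+-mono-≤ (scale α (he r)) (scale β (hf r)) ⟩
        ∣ α ∣ * (K * δ r) + ∣ β ∣ * (L * δ r)    ≡⟨ rearrange (∣ α ∣) K (∣ β ∣) L (δ r) ⟩
        (∣ α ∣ * K + ∣ β ∣ * L) * δ r            ∎
      where
      open ℚₚ.≤-Reasoning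
      scale : ∀ α {x y} → x ≤ y → ∣ α ∣ * x ≤ ∣ α ∣ * y
      scale α = ℚₚ.*-monoˡ-≤-nonNeg ∣ α ∣ {{ℚₚ.∣-∣-nonNeg α}}
      nonneg : ∀ α {x} → 0ℚ ≤ x → 0ℚ ≤ ∣ α ∣ * x
      nonneg α {x} 0≤x = subst (_≤ ∣ α ∣ * x) (ℚₚ.*-zeroʳ ∣ α ∣) (scale α 0≤x)
      rearrange : ∀ a k b l d → a * (k * d) + b * (l * d) ≡ (a * k + b * l) * d
      rearrange = solve-∀ ring

    O-δ : O δ
    O-δ = 1ℚ , ℚₚ.nonNegative⁻¹ 1ℚ , λ r →
      ℚₚ.≤-reflexive (trans (ℚₚ.0≤p⇒∣p∣≡p (0≤δ r)) (sym (ℚₚ.*-identityˡ (δ r))))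

    O-δ* : ∀ {e} → O e → O (λ r → δ r * e r)
    O-δ* {e} (K , 0≤K , h) = K , 0≤K , λ r → begin
        ∣ δ r * e r ∣      ≡⟨ ℚₚ.∣p*q∣≡∣p∣*∣q∣ (δ r) (e r) ⟩
        ∣ δ r ∣ * ∣ e r ∣  ≡⟨ cong (_* ∣ e r ∣) (ℚₚ.0≤p⇒∣p∣≡p (0≤δ r)) ⟩
        δ r * ∣ e r ∣      ≤⟨ ℚₚ.*-monoʳ-≤-nonNeg ∣ e r ∣ {{ℚₚ.∣-∣-nonNeg (e r)}} (δ≤1 r) ⟩
        1ℚ * ∣ e r ∣       ≡⟨ ℚₚ.*-identityˡ ∣ e r ∣ ⟩
        ∣ e r ∣            ≤⟨ h r ⟩
        K * δ r            ∎
      where open ℚₚ.≤-Reasoning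

    O-0 : O (λ _ → 0ℚ)
    O-0 = 0ℚ , ℚₚ.≤-refl , λ r → ℚₚ.≤-reflexive (sym (ℚₚ.*-zeroˡ (δ r)))

    O-D^ : ∀ n {e : ℕ → ℕ → ℚ} → (∀ k → O (λ r → e r k)) → ∀ k → O (λ r → D^ n (e r) k)
    O-D^ zero    h k       = h k
    O-D^ (suc n) h zero    = O-D^ n h zero
    O-D^ (suc n) {e} h (suc k) = O-cong
      (λ r → subtract (D^ n (e r) (suc k)) (D^ n (e r) k))
      (O-linear 1ℚ (- 1ℚ) (O-D^ n h (suc k)) (O-D^ n h k))
      where
      subtract : ∀ x y → 1ℚ * x + - 1ℚ * y ≡ x - y
      subtract = solve-∀ ring

  module Dilation (b : ℕ) .{{_ : ℕ.NonTrivial b}} where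

    δ : ℕ → ℚ
    δ r = recip (b ℕ.^ r) {{b^m≢0 b r}}

    0≤δ : ∀ r → 0ℚ ≤ δ r
    0≤δ r = recip≥0 (b ℕ.^ r) {{b^m≢0 b r}}

    ι-δ : ∀ r → ι (b ℕ.^ r) * δ r ≡ 1ℚ
    ι-δ r = ι-recip (b ℕ.^ r) {{b^m≢0 b r}}

    δ≤1 : ∀ r → δ r ≤ 1ℚ
    δ≤1 r = begin
      δ r                        ≡⟨ ℚₚ.*-identityˡ (δ r) ⟨
      1ℚ * δ r                   ≤⟨ ℚₚ.*-monoʳ-≤-nonNeg (δ r) {{ℚ.nonNegative (0≤δ r)}} 1≤b^r ⟩
      ι (b ℕ.^ r) * δ r          ≡⟨ ι-δ r ⟩
      1ℚ                         ∎
      where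
      open ℚₚ.≤-Reasoning
      1≤b^r : 1ℚ ≤ ι (b ℕ.^ r)
      1≤b^r = ι-mono-≤ (ℕ.>-nonZero⁻¹ (b ℕ.^ r) {{b^m≢0 b r}})

    open BigO δ 0≤δ δ≤1 public

    recip-pow : ℕ → ℕ → ℚ
    recip-pow r m = recip (b ℕ.^ (r ℕ.* m)) {{b^m≢0 b (r ℕ.* m)}}

    recip-b^rm : ∀ r m → recip-pow r m ≡ δ r ^ m
    recip-b^rm r zero    = recip-cong {{b^m≢0 b (r ℕ.* 0)}} (cong (b ℕ.^_) (ℕₚ.*-zeroʳ r))
    recip-b^rm r (suc m) = begin
      recip-pow r (suc m)
        ≡⟨ recip-cong {{b^m≢0 b (r ℕ.* suc m)}} {{product≢0}}
             (trans (cong (b ℕ.^_) (ℕₚ.*-suc r m)) (ℕₚ.^-distribˡ-+-* b r (r ℕ.* m))) ⟩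
      recip (b ℕ.^ r ℕ.* b ℕ.^ (r ℕ.* m)) {{product≢0}}
        ≡⟨ recip-* (b ℕ.^ r) (b ℕ.^ (r ℕ.* m)) {{b^m≢0 b r}} {{b^m≢0 b (r ℕ.* m)}} {{product≢0}} ⟩
      δ r * recip-pow r m
        ≡⟨ cong (δ r *_) (recip-b^rm r m) ⟩
      δ r * δ r ^ m ∎
      where
      open ≡-Reasoning
      product≢0 : ℕ.NonZero (b ℕ.^ r ℕ.* b ℕ.^ (r ℕ.* m))
      product≢0 = ℕₚ.m*n≢0 _ _ {{b^m≢0 b r}} {{b^m≢0 b (r ℕ.* m)}}

    recip-! : ℕ → ℚ
    recip-! j = recip (j !) {{j ℕₚ.!≢0}}

    -- Induction over the factors of `binom`: scaled by δ = b^(-r), the factor (b^r t - l + j) / (j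
    -- + 1) becomes t / (j + 1) plus a multiple of δ. For j = 0 both terms are 1.
    dilated-binom-asymptotics : ∀ j l t →
      O (λ r → δ r ^ j * binom j (ι (b ℕ.^ r ℕ.* t) - ι l) - recip-! j * ι t ^ j)
    dilated-binom-asymptotics zero    l t = O-0
    dilated-binom-asymptotics (suc j) l t = O-cong (λ r → sym (step r))
      -- The old error is multiplied by t / (j + 1). The offset j - l adds δ times the previous
      -- quantity, which is split into its error and its limit f τ^j.
      (O-linear (ρ * τ) 1ℚ ih (O-linear (c * ρ) (c * ρ * f * τ ^ j) (O-δ* ih) O-δ))
      where
      open ≡-Reasoning
      ρ = recip (suc j)
      τ = ι t
      c = ι j - ι l
      f = recip-! j
      p : ℕ → ℚ
      p r = binom j (ι (b ℕ.^ r ℕ.* t) - ι l)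
      e : ℕ → ℚ
      e r = δ r ^ j * p r - f * τ ^ j
      ih : O e
      ih = dilated-binom-asymptotics j l t
      expand : ∀ d dj β τ l j ρ p f τj →
        d * dj * ((β * τ - l + j) * ρ * p) - ρ * f * (τ * τj)
          ≡ (β * d) * (ρ * τ * (dj * p)) - ρ * f * (τ * τj) + (j - l) * ρ * (d * (dj * p))
      expand = solve-∀ ring
      collect : ∀ d dj τ c ρ p f τj →
        1ℚ * (ρ * τ * (dj * p)) - ρ * f * (τ * τj) + c * ρ * (d * (dj * p))
          ≡ ρ * τ * (dj * p - f * τj) + 1ℚ * (c * ρ * (d * (dj * p - f * τj)) + c * ρ * f * τj * d)
      collect = solve-∀ ring
      step : ∀ r →
        δ r ^ suc j * binom (suc j) (ι (b ℕ.^ r ℕ.* t) - ι l) - recip-! (suc j) * τ ^ suc j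
          ≡ ρ * τ * e r + 1ℚ * (c * ρ * (δ r * e r) + c * ρ * f * τ ^ j * δ r)
      step r = begin
        δ r ^ suc j * ((ι (b ℕ.^ r ℕ.* t) - ι l + ι j) * ρ * p r) - recip-! (suc j) * τ ^ suc j
          ≡⟨ cong₂ (λ x y → δ r ^ suc j * ((x - ι l + ι j) * ρ * p r) - y * τ ^ suc j)
               (ι-* (b ℕ.^ r) t) (recip-* (suc j) (j !) {{_}} {{j ℕₚ.!≢0}} {{suc j ℕₚ.!≢0}}) ⟩
        δ r * δ r ^ j * ((ι (b ℕ.^ r) * τ - ι l + ι j) * ρ * p r) - ρ * f * (τ * τ ^ j)
          ≡⟨ expand (δ r) (δ r ^ j) (ι (b ℕ.^ r)) τ (ι l) (ι j) ρ (p r) f (τ ^ j) ⟩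
        (ι (b ℕ.^ r) * δ r) * (ρ * τ * (δ r ^ j * p r)) - ρ * f * (τ * τ ^ j) + c * ρ * (δ r * (δ r ^ j * p r))
          ≡⟨ cong (λ x → x * (ρ * τ * (δ r ^ j * p r)) - ρ * f * (τ * τ ^ j) + c * ρ * (δ r * (δ r ^ j * p r)))
               (ι-δ r) ⟩
        1ℚ * (ρ * τ * (δ r ^ j * p r)) - ρ * f * (τ * τ ^ j) + c * ρ * (δ r * (δ r ^ j * p r))
          ≡⟨ collect (δ r) (δ r ^ j) τ c ρ (p r) f (τ ^ j) ⟩
        ρ * τ * e r + 1ℚ * (c * ρ * (δ r * e r) + c * ρ * f * τ ^ j * δ r) ∎

    -- For l < m, the coefficient of x^i in (1 - x)^(m + 1) times the r-th iterate of Φ_b at x^l /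
    -- (1 - x)^(m + 1).
    numerator : ℕ → ℕ → ℕ → ℕ → ℚ
    numerator m r l i = D^ (suc m) (λ k → binom m (ι (b ℕ.^ r ℕ.* suc k) - ι l)) i

    -- The i-th entry after m + 1 differences involves finitely many k, so the estimate for each
    -- single k passes through `D^`.
    numerator-limit : ∀ m l i →
      O (λ r → recip-pow r m * numerator m r l i
             - recip-! m * D^ (suc m) (λ k → ι (suc k) ^ m) i)
    numerator-limit m l i = O-cong
      (λ r → begin
        D^ (suc m) (λ k → δ r ^ m * P r k + - recip-! m * ι (suc k) ^ m) i
          ≡⟨ D^-linear (suc m) (δ r ^ m) (P r) (- recip-! m) (λ k → ι (suc k) ^ m) i ⟩
        δ r ^ m * D^ (suc m) (P r) i + - recip-! m * A
          ≡⟨ cong₂ (λ x y → x * D^ (suc m) (P r) i + y) (recip-b^rm r m) (ℚₚ.neg-distribˡ-* (recip-! m) A) ⟨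
        recip-pow r m * D^ (suc m) (P r) i - recip-! m * A  ∎)
      (O-D^ (suc m) (λ k → O-cong
        (λ r → cong (δ r ^ m * P r k +_) (ℚₚ.neg-distribˡ-* (recip-! m) (ι (suc k) ^ m)))
        (dilated-binom-asymptotics m l (suc k))) i)
      where
      open ≡-Reasoning
      P : ℕ → ℕ → ℚ
      P r k = binom m (ι (b ℕ.^ r ℕ.* suc k) - ι l)
      A = D^ (suc m) (λ k → ι (suc k) ^ m) i

  -- Eulerian numbers

  private variable
    ℓ ℓ′ : Level
    A B : Set

  sumBy : (A → ℚ) → List A → ℚ
  sumBy φ = List.foldr (λ x s → φ x + s) 0ℚ

  sumBy-cong : ∀ {φ ψ : A → ℚ} → φ ≗ ψ → sumBy φ ≗ sumBy ψ
  sumBy-cong e []       = refl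
  sumBy-cong e (x ∷ xs) = cong₂ _+_ (e x) (sumBy-cong e xs)

  sumBy-++ : ∀ (φ : A → ℚ) xs ys → sumBy φ (xs ++ ys) ≡ sumBy φ xs + sumBy φ ys
  sumBy-++ φ []       ys = sym (ℚₚ.+-identityˡ _)
  sumBy-++ φ (x ∷ xs) ys = trans (cong (λ s → φ x + s) (sumBy-++ φ xs ys)) (sym (ℚₚ.+-assoc (φ x) _ _))

  sumBy-map : ∀ (φ : B → ℚ) (f : A → B) xs → sumBy φ (List.map f xs) ≡ sumBy (φ ∘ f) xs
  sumBy-map φ f []       = refl
  sumBy-map φ f (x ∷ xs) = cong (λ s → φ (f x) + s) (sumBy-map φ f xs)

  sumBy-concatMap : ∀ (φ : B → ℚ) (f : A → List B) xs →
    sumBy φ (concatMap f xs) ≡ sumBy (sumBy φ ∘ f) xs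
  sumBy-concatMap φ f []       = refl
  sumBy-concatMap φ f (x ∷ xs) = trans (sumBy-++ φ (f x) (concatMap f xs))
    (cong (λ s → sumBy φ (f x) + s) (sumBy-concatMap φ f xs))

  sumBy-tabulate : ∀ {n} (φ : A → ℚ) (f : Fin n → A) → sumBy φ (List.tabulate f) ≡ sum (φ ∘ f)
  sumBy-tabulate {n = zero}  φ f = refl
  sumBy-tabulate {n = suc n} φ f = cong (λ s → φ (f zero) + s) (sumBy-tabulate φ (f ∘ suc))

  sumBy-mono : ∀ (g : A → ℕ) k xs →
    ι (length (filter (λ x → g x ℕₚ.≟ k) xs)) ≡ sumBy (λ x → mono (g x) k) xs
  sumBy-mono g k []       = refl
  sumBy-mono g k (x ∷ xs) with ih ← sumBy-mono g k xs | g x ℕ.≡ᵇ k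
  ... | true  = trans (ι-suc (length (filter (λ x → g x ℕₚ.≟ k) xs))) (cong (λ s → 1ℚ + s) ih)
  ... | false = trans ih (sym (ℚₚ.+-identityˡ _))

  -- Filtered lists and permutations by their first letter

  module _ {P : Pred A ℓ} {Q : Pred A ℓ′} (P? : Decidable P) (Q? : Decidable Q) where

    filter-does : (∀ x → does (P? x) ≡ does (Q? x)) → filter P? ≗ filter Q?
    filter-does e []       = refl
    filter-does e (x ∷ xs) rewrite e x with does (Q? x)
    ... | true  = cong (x ∷_) (filter-does e xs)
    ... | false = filter-does e xs

  filter-false : ∀ {P : Pred A ℓ} (P? : Decidable P) → (∀ x → does (P? x) ≡ false) → ∀ xs → filter P? xs ≡ []
  filter-false P? e []       = refl
  filter-false P? e (x ∷ xs) rewrite e x = filter-false P? e xs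

  filter-∧ : ∀ {P Q R : Pred A ℓ} (P? : Decidable P) (Q? : Decidable Q) (R? : Decidable R) →
    (∀ x → does (R? x) ≡ does (P? x) ∧ does (Q? x)) → filter R? ≗ filter Q? ∘ filter P?
  filter-∧ P? Q? R? e []       = refl
  filter-∧ P? Q? R? e (x ∷ xs) rewrite e x with does (P? x)
  ... | false = filter-∧ P? Q? R? e xs
  ... | true with does (Q? x)
  ...   | true  = cong (x ∷_) (filter-∧ P? Q? R? e xs)
  ...   | false = filter-∧ P? Q? R? e xs

  filter-map : ∀ {P : Pred B ℓ} (P? : Decidable P) (f : A → B) xs →
    filter P? (List.map f xs) ≡ List.map f (filter (P? ∘ f) xs)
  filter-map P? f []       = refl
  filter-map P? f (x ∷ xs) with does (P? (f x))
  ... | true  = cong (f x ∷_) (filter-map P? f xs)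
  ... | false = filter-map P? f xs

  -- Used with the condition of differing from a first letter i, to turn the words that avoid i into
  -- all words over a smaller alphabet.
  filter-words : ∀ {P : Pred A ℓ} (P? : Decidable P) xs k →
    filter (All.all? P?) (words A xs k) ≡ words A (filter P? xs) k
  filter-words P? xs zero    = refl
  filter-words {A = A} P? xs (suc k) = trans (letters xs)
    (cong (cartesianProductWith _∷_ (filter P? xs)) (filter-words P? xs k))
    where
    W = words A xs k
    letters : ∀ ys → filter (All.all? P?) (cartesianProductWith _∷_ ys W)
                   ≡ cartesianProductWith _∷_ (filter P? ys) (filter (All.all? P?) W)
    letters []       = refl
    letters (y ∷ ys) = trans (Listₚ.filter-++ (All.all? P?) (List.map (y ∷_) W) _)
      (trans (cong₂ _++_ (filter-map (All.all? P?) (y ∷_) W) (letters ys)) first)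
      where
      rest = cartesianProductWith _∷_ (filter P? ys) (filter (All.all? P?) W)
      first : List.map (y ∷_) (filter (All.all? P? ∘ (y ∷_)) W) ++ rest
            ≡ cartesianProductWith _∷_ (filter P? (y ∷ ys)) (filter (All.all? P?) W)
      first with does (P? y) in eq
      ... | true  = cong (λ V → List.map (y ∷_) V ++ rest)
        (filter-does (All.all? P? ∘ (y ∷_)) (All.all? P?) (λ w → cong (_∧ does (All.all? P? w)) eq) W)
      ... | false = cong (λ V → List.map (y ∷_) V ++ rest)
        (filter-false (All.all? P? ∘ (y ∷_)) (λ w → cong (_∧ does (All.all? P? w)) eq) W)

  words-map : ∀ (f : A → B) xs k → words B (List.map f xs) k ≡ List.map (Vec.map f) (words A xs k)
  words-map f xs zero    = refl
  words-map {A = A} f xs (suc k) = trans (cong (cartesianProductWith _∷_ (List.map f xs)) (words-map f xs k)) (letters xs)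
    where
    W = words A xs k
    letters : ∀ ys → cartesianProductWith _∷_ (List.map f ys) (List.map (Vec.map f) W)
                   ≡ List.map (Vec.map f) (cartesianProductWith _∷_ ys W)
    letters []       = refl
    letters (y ∷ ys) = trans
      (cong₂ _++_ (trans (sym (Listₚ.map-∘ W)) (Listₚ.map-∘ W)) (letters ys))
      (sym (Listₚ.map-++ (Vec.map f) (List.map (y ∷_) W) _))

  filter-≢ : ∀ {m} (i : Fin (suc m)) →
    filter (λ j → ¬? (i Finₚ.≟ j)) (allFin (suc m)) ≡ List.map (punchIn i) (allFin m)
  filter-≢ {m} zero = begin
    filter (λ j → ¬? (zero Finₚ.≟ j)) (List.tabulate suc)
      ≡⟨ cong (filter (λ j → ¬? (zero Finₚ.≟ j))) (Listₚ.map-tabulate (λ j → j) suc) ⟨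
    filter (λ j → ¬? (zero Finₚ.≟ j)) (List.map suc (allFin m))
      ≡⟨ filter-map (λ j → ¬? (zero Finₚ.≟ j)) suc (allFin m) ⟩
    List.map suc (filter (λ j → ¬? (zero Finₚ.≟ suc j)) (allFin m))
      ≡⟨ cong (List.map suc) (keep (allFin m)) ⟩
    List.map suc (allFin m) ∎
    where
    open ≡-Reasoning
    keep : ∀ (xs : List (Fin m)) → filter (λ j → ¬? (zero Finₚ.≟ suc j)) xs ≡ xs
    keep []       = refl
    keep (x ∷ xs) = cong (x ∷_) (keep xs)
  filter-≢ {suc m} (suc i) = cong (zero ∷_) (begin
    filter (λ j → ¬? (suc i Finₚ.≟ j)) (List.tabulate suc)
      ≡⟨ cong (filter (λ j → ¬? (suc i Finₚ.≟ j))) (Listₚ.map-tabulate (λ j → j) suc) ⟨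
    filter (λ j → ¬? (suc i Finₚ.≟ j)) (List.map suc (allFin (suc m)))
      ≡⟨ filter-map (λ j → ¬? (suc i Finₚ.≟ j)) suc (allFin (suc m)) ⟩
    List.map suc (filter (λ j → ¬? (suc i Finₚ.≟ suc j)) (allFin (suc m)))
      ≡⟨ cong (List.map suc)
           (filter-does (λ j → ¬? (suc i Finₚ.≟ suc j)) (λ j → ¬? (i Finₚ.≟ j)) (λ j → refl) (allFin (suc m))) ⟩
    List.map suc (filter (λ j → ¬? (i Finₚ.≟ j)) (allFin (suc m)))
      ≡⟨ cong (List.map suc) (filter-≢ i) ⟩
    List.map suc (List.map (punchIn i) (allFin m))
      ≡⟨ trans (sym (Listₚ.map-∘ (allFin m))) (Listₚ.map-∘ (allFin m)) ⟩
    List.map (punchIn (suc i)) (List.map suc (allFin m))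
      ≡⟨ cong (List.map (punchIn (suc i))) (Listₚ.map-tabulate (λ j → j) suc) ⟩
    List.map (punchIn (suc i)) (List.tabulate suc) ∎)
    where open ≡-Reasoning

  unique?-map : ∀ {m n k} (f : Fin m → Fin n) → (∀ i j → f i ≡ f j → i ≡ j) → (w : Vec (Fin m) k) →
    does (unique? (Vec.map f w)) ≡ does (unique? w)
  unique?-map f inj []      = refl
  unique?-map f inj (i ∷ w) = cong₂ _∧_ (fresh w) (unique?-map f inj w)
    where
    fresh : ∀ {k} (w : Vec _ k) → does (All.all? (λ j → ¬? (f i Finₚ.≟ j)) (Vec.map f w))
                                 ≡ does (All.all? (λ j → ¬? (i Finₚ.≟ j)) w)
    fresh []      = refl
    fresh (j ∷ w) = cong₂ _∧_
      (cong not (does-⇔ (mk⇔ (inj i j) (cong f)) (f i Finₚ.≟ f j) (i Finₚ.≟ j))) (fresh w)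

  permutations-suc : ∀ m → permutations (suc m) ≡
    concatMap (λ i → List.map (λ w → i ∷ Vec.map (punchIn i) w) (permutations m)) (allFin (suc m))
  permutations-suc m = trans (byFirst (allFin (suc m))) (Listₚ.concatMap-cong tails (allFin (suc m)))
    where
    W = words (Fin (suc m)) (allFin (suc m)) m
    byFirst : ∀ xs → filter unique? (cartesianProductWith _∷_ xs W)
                   ≡ concatMap (λ i → List.map (i ∷_) (filter (unique? ∘ (i ∷_)) W)) xs
    byFirst []       = refl
    byFirst (x ∷ xs) = trans (Listₚ.filter-++ unique? (List.map (x ∷_) W) _)
      (cong₂ _++_ (filter-map unique? (x ∷_) W) (byFirst xs))
    tails : ∀ i → List.map (i ∷_) (filter (unique? ∘ (i ∷_)) W)
                ≡ List.map (λ w → i ∷ Vec.map (punchIn i) w) (permutations m)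
    tails i = begin
      List.map (i ∷_) (filter (unique? ∘ (i ∷_)) W)
        ≡⟨ cong (List.map (i ∷_)) (filter-∧ (All.all? i≢?) unique? (unique? ∘ (i ∷_)) (λ w → refl) W) ⟩
      List.map (i ∷_) (filter unique? (filter (All.all? i≢?) W))
        ≡⟨ cong (List.map (i ∷_) ∘ filter unique?) (trans (filter-words i≢? (allFin (suc m)) m)
             (trans (cong (λ xs → words _ xs m) (filter-≢ i)) (words-map (punchIn i) (allFin m) m))) ⟩
      List.map (i ∷_) (filter unique? (List.map (Vec.map (punchIn i)) V))
        ≡⟨ cong (List.map (i ∷_)) (filter-map unique? (Vec.map (punchIn i)) V) ⟩
      List.map (i ∷_) (List.map (Vec.map (punchIn i)) (filter (unique? ∘ Vec.map (punchIn i)) V))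
        ≡⟨ cong (List.map (i ∷_) ∘ List.map (Vec.map (punchIn i)))
             (filter-does _ unique? (unique?-map (punchIn i) (Finₚ.punchIn-injective i)) V) ⟩
      List.map (i ∷_) (List.map (Vec.map (punchIn i)) (permutations m))
        ≡⟨ Listₚ.map-∘ (permutations m) ⟨
      List.map (λ w → i ∷ Vec.map (punchIn i) w) (permutations m) ∎
      where
      open ≡-Reasoning
      V = words (Fin m) (allFin m) m
      i≢? = λ j → ¬? (i Finₚ.≟ j)

  descents-map-punchIn : ∀ {m k} (i : Fin (suc m)) (w : Vec (Fin m) k) → descents (Vec.map (punchIn i) w) ≡ descents w
  descents-map-punchIn i []          = refl
  descents-map-punchIn i (j ∷ [])    = refl
  descents-map-punchIn i (j ∷ l ∷ w) = cong₂ (λ c d → (if c then 1 else 0) ℕ.+ d)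
    (does-⇔ (mk⇔ (λ p → ℕₚ.≰⇒> λ q → ℕₚ.<⇒≱ p (Finₚ.punchIn-mono-≤ i j l q))
                 (λ p → ℕₚ.≰⇒> λ q → ℕₚ.<⇒≱ p (Finₚ.punchIn-cancel-≤ i j l q)))
      (punchIn i l Finₚ.<? punchIn i j) (l Finₚ.<? j))
    (descents-map-punchIn i (l ∷ w))

  -- Letters below i keep their value and the others move above i, so the descent can be read off
  -- before the renaming.
  punchIn-<ᵇ : ∀ {m} (i : Fin (suc m)) (j : Fin m) → does (punchIn i j Finₚ.<? i) ≡ (toℕ j ℕ.<ᵇ toℕ i)
  punchIn-<ᵇ zero    j       = refl
  punchIn-<ᵇ (suc i) zero    = refl
  punchIn-<ᵇ (suc i) (suc j) = punchIn-<ᵇ i j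

  descents-∷-punchIn : ∀ {m k} (i : Fin (suc m)) (j : Fin m) (w : Vec (Fin m) k) →
    descents (i ∷ Vec.map (punchIn i) (j ∷ w))
      ≡ (if toℕ j ℕ.<ᵇ toℕ i then 1 else 0) ℕ.+ descents (j ∷ w)
  descents-∷-punchIn i j w = cong₂ (λ c d → (if c then 1 else 0) ℕ.+ d)
    (punchIn-<ᵇ i j) (descents-map-punchIn i (j ∷ w))

  -- The factor x that a descent at the first position contributes, or 1 if there is none.
  X? : Bool → (ℕ → ℚ) → ℕ → ℚ
  X? c s = if c then X s else s

  X?-cong : ∀ c {s t} → s ≗ t → X? c s ≗ X? c t
  X?-cong true  = X-cong
  X?-cong false e = e

  X?-mono : ∀ c d → mono ((if c then 1 else 0) ℕ.+ d) ≗ X? c (mono d)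
  X?-mono true  d k = sym (X-mono d k)
  X?-mono false d k = refl

  D^-X? : ∀ n c s → X? c (D^ n s) ≗ D^ n (X? c s)
  D^-X? n true  s k = sym (D^-X n s k)
  D^-X? n false s k = refl

  sumBy-X? : ∀ c (s : A → ℕ → ℚ) xs →
    (λ k → sumBy (λ x → X? c (s x) k) xs) ≗ X? c (λ k → sumBy (λ x → s x k) xs)
  sumBy-X? false s xs k       = refl
  sumBy-X? true  s xs (suc k) = refl
  sumBy-X? true  s []       zero = refl
  sumBy-X? true  s (x ∷ xs) zero = trans (ℚₚ.+-identityˡ _) (sumBy-X? true s xs zero)

  -- punchIn i renames the letters of a permutation of {0, …, m - 1} to those of {0, …, m} other than i.
  descentsFrom : ∀ m → Fin (suc m) → ℕ → ℚ
  descentsFrom m i k = sumBy (λ w → mono (descents (i ∷ Vec.map (punchIn i) w)) k) (permutations m)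

  -- Sorting by the second letter: if it is j before the renaming, it makes a descent exactly when j
  -- < i, and what remains is counted by `descentsFrom m j`.
  descentsFrom-suc : ∀ m i k → descentsFrom (suc m) i k
    ≡ sum (λ j → X? (toℕ j ℕ.<ᵇ toℕ i) (descentsFrom m j) k)
  descentsFrom-suc m i k = begin
    sumBy φ (permutations (suc m))
      ≡⟨ cong (sumBy φ) (permutations-suc m) ⟩
    sumBy φ (concatMap (λ j → List.map (λ w → j ∷ Vec.map (punchIn j) w) (permutations m)) (allFin (suc m)))
      ≡⟨ sumBy-concatMap φ (λ j → List.map (λ w → j ∷ Vec.map (punchIn j) w) (permutations m)) (allFin (suc m)) ⟩
    sumBy (λ j → sumBy φ (List.map (λ w → j ∷ Vec.map (punchIn j) w) (permutations m))) (allFin (suc m))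
      ≡⟨ sumBy-cong (λ j → trans (sumBy-map φ _ (permutations m))
           (trans (sumBy-cong (λ w → trans (cong (λ d → mono d k) (descents-∷-punchIn i j (Vec.map (punchIn j) w)))
             (X?-mono (toℕ j ℕ.<ᵇ toℕ i) (descents (j ∷ Vec.map (punchIn j) w)) k)) (permutations m))
           (sumBy-X? (toℕ j ℕ.<ᵇ toℕ i) (λ w → mono (descents (j ∷ Vec.map (punchIn j) w))) (permutations m) k)))
           (allFin (suc m)) ⟩
    sumBy (λ j → X? (toℕ j ℕ.<ᵇ toℕ i) (descentsFrom m j) k) (allFin (suc m))
      ≡⟨ sumBy-tabulate (λ j → X? (toℕ j ℕ.<ᵇ toℕ i) (descentsFrom m j) k) (λ j → j) ⟩
    sum (λ j → X? (toℕ j ℕ.<ᵇ toℕ i) (descentsFrom m j) k) ∎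
    where
    open ≡-Reasoning
    φ : Vec _ _ → ℚ
    φ w = mono (descents (i ∷ Vec.map (punchIn i) w)) k

  -- The least letter in front creates no descent.
  eulerian≡descentsFrom : ∀ m k → ι (eulerian m k) ≡ descentsFrom m zero k
  eulerian≡descentsFrom m k = trans (sumBy-mono descents k (permutations m))
    (sumBy-cong (λ w → cong (λ d → mono d k) (sym (from-zero w))) (permutations m))
    where
    from-zero : ∀ {k} (w : Vec (Fin m) k) → descents (zero ∷ Vec.map suc w) ≡ descents w
    from-zero []      = refl
    from-zero (j ∷ w) = descents-map-punchIn zero (j ∷ w)

  -- Products of powers that solve the recursion

  sum-sub : ∀ {n} (f g : Fin n → ℚ) → sum f - sum g ≡ sum (λ j → f j - g j)
  sum-sub {zero}  f g = refl
  sum-sub {suc n} f g = trans (rearrange (f zero) (sum (f ∘ suc)) (g zero) (sum (g ∘ suc)))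
    (cong (λ s → f zero - g zero + s) (sum-sub (f ∘ suc) (g ∘ suc)))
    where
    rearrange : ∀ a s b t → (a + s) - (b + t) ≡ (a - b) + (s - t)
    rearrange = solve-∀ ring

  D^-sum : ∀ n {l} (s : Fin l → ℕ → ℚ) → D^ n (λ k → sum (λ j → s j k)) ≗ λ k → sum (λ j → D^ n (s j) k)
  D^-sum zero    s k       = refl
  D^-sum (suc n) s zero    = D^-sum n s zero
  D^-sum (suc n) s (suc k) = trans (cong₂ _-_ (D^-sum n s (suc k)) (D^-sum n s k)) 
    (sum-sub (λ j → D^ n (s j) (suc k)) (λ j → D^ n (s j) k))

  -- Two geometric sums, with α and β as induction loading.
  telescope : ∀ a b c → b ≡ 1ℚ + a → c ≡ 1ℚ + b → ∀ m i → i ℕ.≤ m → ∀ α β →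
    sum {m} (λ j → if toℕ j ℕ.<ᵇ i then α * (a ^ toℕ j * b ^ (m ℕ.∸ suc (toℕ j)))
                                   else β * (b ^ toℕ j * c ^ (m ℕ.∸ suc (toℕ j))))
      ≡ α * (b ^ m - a ^ i * b ^ (m ℕ.∸ i)) + β * (b ^ i * c ^ (m ℕ.∸ i) - b ^ m)
  telescope a b c b≡ c≡ = go
    where
    open ≡-Reasoning
    term : ∀ m i → ℚ → ℚ → Fin m → ℚ
    term m i α β j = if toℕ j ℕ.<ᵇ i then α * (a ^ toℕ j * b ^ (m ℕ.∸ suc (toℕ j)))
                                     else β * (b ^ toℕ j * c ^ (m ℕ.∸ suc (toℕ j)))
    absorb : ∀ α x y z → α * (x * y * z) ≡ α * x * (y * z)
    absorb = solve-∀ ring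
    go : ∀ m i → i ℕ.≤ m → ∀ α β → sum (term m i α β)
      ≡ α * (b ^ m - a ^ i * b ^ (m ℕ.∸ i)) + β * (b ^ i * c ^ (m ℕ.∸ i) - b ^ m)
    go zero zero z≤n α β = empty α β
      where
      empty : ∀ α β → 0ℚ ≡ α * (1ℚ - 1ℚ * 1ℚ) + β * (1ℚ * 1ℚ - 1ℚ)
      empty = solve-∀ ring
    go (suc m) zero z≤n α β = begin
      β * (1ℚ * c ^ m) + sum (λ (j : Fin m) → β * (b * b ^ toℕ j * c ^ (m ℕ.∸ suc (toℕ j))))
        ≡⟨ cong (λ s → β * (1ℚ * c ^ m) + s) (sum-cong-≋ (λ (j : Fin m) → absorb β b (b ^ toℕ j) (c ^ (m ℕ.∸ suc (toℕ j))))) ⟩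
      β * (1ℚ * c ^ m) + sum (term m 0 α (β * b))
        ≡⟨ cong (λ s → β * (1ℚ * c ^ m) + s) (go m 0 z≤n α (β * b)) ⟩
      β * (1ℚ * c ^ m) + (α * (b ^ m - 1ℚ * b ^ m) + β * b * (1ℚ * c ^ m - b ^ m))
        ≡⟨ collect b α β (b ^ m) (c ^ m) ⟩
      α * (b * b ^ m - 1ℚ * (b * b ^ m)) + β * (1ℚ * ((1ℚ + b) * c ^ m) - b * b ^ m)
        ≡⟨ cong (λ x → α * (b * b ^ m - 1ℚ * (b * b ^ m)) + β * (1ℚ * (x * c ^ m) - b * b ^ m)) c≡ ⟨
      α * (b * b ^ m - 1ℚ * (b * b ^ m)) + β * (1ℚ * (c * c ^ m) - b * b ^ m) ∎
      where
      collect : ∀ b α β bm cm →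
        β * (1ℚ * cm) + (α * (bm - 1ℚ * bm) + β * b * (1ℚ * cm - bm))
          ≡ α * (b * bm - 1ℚ * (b * bm)) + β * (1ℚ * ((1ℚ + b) * cm) - b * bm)
      collect = solve-∀ ring
    go (suc m) (suc i) (s≤s i≤m) α β = begin
      α * (1ℚ * b ^ m) + sum (λ j → term (suc m) (suc i) α β (suc j))
        ≡⟨ cong (λ s → α * (1ℚ * b ^ m) + s) (sum-cong-≋ shift) ⟩
      α * (1ℚ * b ^ m) + sum (term m i (α * a) (β * b))
        ≡⟨ cong (λ s → α * (1ℚ * b ^ m) + s) (go m i i≤m (α * a) (β * b)) ⟩
      α * (1ℚ * b ^ m) + (α * a * (b ^ m - ai * bmi) + β * b * (bi * cmi - b ^ m))
        ≡⟨ collect a b α β (b ^ m) ai bi bmi cmi ⟩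
      α * ((1ℚ + a) * b ^ m - a * ai * bmi) + β * (b * bi * cmi - b * b ^ m)
        ≡⟨ cong (λ x → α * (x * b ^ m - a * ai * bmi) + β * (b * bi * cmi - b * b ^ m)) b≡ ⟨
      α * (b * b ^ m - a * ai * bmi) + β * (b * bi * cmi - b * b ^ m) ∎
      where
      ai = a ^ i
      bi = b ^ i
      bmi = b ^ (m ℕ.∸ i)
      cmi = c ^ (m ℕ.∸ i)
      shift : ∀ j → term (suc m) (suc i) α β (suc j) ≡ term m i (α * a) (β * b) j
      shift j with toℕ j ℕ.<ᵇ i
      ... | true  = absorb α a (a ^ toℕ j) (b ^ (m ℕ.∸ suc (toℕ j)))
      ... | false = absorb β b (b ^ toℕ j) (c ^ (m ℕ.∸ suc (toℕ j)))
      collect : ∀ a b α β bm ai bi bmi cmi →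
        α * (1ℚ * bm) + (α * a * (bm - ai * bmi) + β * b * (bi * cmi - bm))
          ≡ α * ((1ℚ + a) * bm - a * ai * bmi) + β * (b * bi * cmi - b * bm)
      collect = solve-∀ ring

  -- This counts the maps from the m letters other than i to {0, ..., t} that avoid 0 on the i
  -- letters below i. Sorting the letters by value, with ties in increasing order, gives a word w,
  -- and i ∷ w has its descents where the values must rise strictly from the initial value 0.
  powers : ℕ → ℕ → ℕ → ℚ
  powers m i t = ι t ^ i * ι (suc t) ^ (m ℕ.∸ i)

  -- The terms j < i and the terms j ≥ i form geometric sums whose bases differ by 1. At index t + 1
  -- both contain (t + 1)^(m + 1), with opposite signs, and the rest is the difference of `powers`.
  D-powers : ∀ m i → i ℕ.≤ suc m →
    (λ t → sum (λ (j : Fin (suc m)) → X? (toℕ j ℕ.<ᵇ i) (powers m (toℕ j)) t)) ≗ D (powers (suc m) i)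
  D-powers m i i≤ zero = begin
    sum (λ (j : Fin (suc m)) → X? (toℕ j ℕ.<ᵇ i) (powers m (toℕ j)) zero)
      ≡⟨ sum-cong-≋ scale ⟩
    -- The terms j < i are shifted and vanish at index 0. The weight 0 switches their sum off, and
    -- the base -1 only continues the pattern a, a + 1, a + 2 to t = -1.
    _ ≡⟨ telescope (- 1ℚ) 0ℚ 1ℚ refl refl (suc m) i i≤ 0ℚ 1ℚ ⟩
    0ℚ * (0ℚ * 0ℚ ^ m - (- 1ℚ) ^ i * 0ℚ ^ (suc m ℕ.∸ i)) + 1ℚ * (powers (suc m) i 0 - 0ℚ * 0ℚ ^ m)
      ≡⟨ simplify (0ℚ ^ m) ((- 1ℚ) ^ i) (powers (suc m) i 0) (0ℚ ^ (suc m ℕ.∸ i)) ⟩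
    powers (suc m) i 0 ∎
    where
    open ≡-Reasoning
    simplify : ∀ x z p u → 0ℚ * (0ℚ * x - z * u) + 1ℚ * (p - 0ℚ * x) ≡ p
    simplify = solve-∀ ring
    scale : ∀ (j : Fin (suc m)) → X? (toℕ j ℕ.<ᵇ i) (powers m (toℕ j)) zero ≡
      (if toℕ j ℕ.<ᵇ i then 0ℚ * ((- 1ℚ) ^ toℕ j * 0ℚ ^ (m ℕ.∸ toℕ j)) else 1ℚ * powers m (toℕ j) 0)
    scale j with toℕ j ℕ.<ᵇ i
    ... | true  = sym (ℚₚ.*-zeroˡ ((- 1ℚ) ^ toℕ j * 0ℚ ^ (m ℕ.∸ toℕ j)))
    ... | false = sym (ℚₚ.*-identityˡ _)
  D-powers m i i≤ (suc t) = begin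
    sum (λ (j : Fin (suc m)) → X? (toℕ j ℕ.<ᵇ i) (powers m (toℕ j)) (suc t))
      ≡⟨ sum-cong-≋ scale ⟩
    _ ≡⟨ telescope (ι t) (ι (suc t)) (ι (suc (suc t))) (ι-suc t) (ι-suc (suc t)) (suc m) i i≤ 1ℚ 1ℚ ⟩
    1ℚ * (ι (suc t) ^ suc m - powers (suc m) i t) + 1ℚ * (powers (suc m) i (suc t) - ι (suc t) ^ suc m)
      ≡⟨ simplify (ι (suc t) ^ suc m) (powers (suc m) i t) (powers (suc m) i (suc t)) ⟩
    powers (suc m) i (suc t) - powers (suc m) i t ∎
    where
    open ≡-Reasoning
    simplify : ∀ x p q → 1ℚ * (x - p) + 1ℚ * (q - x) ≡ q - p
    simplify = solve-∀ ring
    scale : ∀ (j : Fin (suc m)) → X? (toℕ j ℕ.<ᵇ i) (powers m (toℕ j)) (suc t) ≡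
      (if toℕ j ℕ.<ᵇ i then 1ℚ * powers m (toℕ j) t else 1ℚ * powers m (toℕ j) (suc t))
    scale j with toℕ j ℕ.<ᵇ i
    ... | true  = sym (ℚₚ.*-identityˡ _)
    ... | false = sym (ℚₚ.*-identityˡ _)

  -- `D^` commutes with `X?` and with sums, so the recursion acts directly on `powers`, where
  -- `D-powers` supplies the additional difference.
  descentsFrom≡D^-powers : ∀ m i → descentsFrom m i ≗ D^ (suc m) (powers m (toℕ i))
  descentsFrom≡D^-powers zero    zero zero          = refl
  descentsFrom≡D^-powers zero    zero (suc k)       = refl
  descentsFrom≡D^-powers (suc m) i k = begin
    descentsFrom (suc m) i k
      ≡⟨ descentsFrom-suc m i k ⟩
    sum (λ j → X? (toℕ j ℕ.<ᵇ toℕ i) (descentsFrom m j) k)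
      ≡⟨ sum-cong-≋ (λ j → trans (X?-cong (toℕ j ℕ.<ᵇ toℕ i) (descentsFrom≡D^-powers m j) k)
                                 (D^-X? (suc m) (toℕ j ℕ.<ᵇ toℕ i) (powers m (toℕ j)) k)) ⟩
    sum (λ (j : Fin (suc m)) → D^ (suc m) (X? (toℕ j ℕ.<ᵇ toℕ i) (powers m (toℕ j))) k)
      ≡⟨ D^-sum (suc m) (λ (j : Fin (suc m)) → X? (toℕ j ℕ.<ᵇ toℕ i) (powers m (toℕ j))) k ⟨
    D^ (suc m) (λ t → sum (λ (j : Fin (suc m)) → X? (toℕ j ℕ.<ᵇ toℕ i) (powers m (toℕ j)) t)) k
      ≡⟨ D^-cong (suc m) (D-powers m (toℕ i) (ℕₚ.≤-pred (Finₚ.toℕ<n i))) k ⟩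
    D^ (suc m) (D (powers (suc m) (toℕ i))) k
      ≡⟨ cong (λ s → s k) (D^-comm (suc m) (powers (suc m) (toℕ i))) ⟩
    D^ (suc (suc m)) (powers (suc m) (toℕ i)) k ∎
    where open ≡-Reasoning

  -- A_m (x) / (1 - x)^(m + 1) = Σ (k + 1)^m x^k.
  eulerian≡D^ : ∀ m k → ι (eulerian m k) ≡ D^ (suc m) (λ t → ι (suc t) ^ m) k
  eulerian≡D^ m k = trans (eulerian≡descentsFrom m k) (trans (descentsFrom≡D^-powers m zero k)
    (D^-cong (suc m) (λ t → ℚₚ.*-identityˡ (ι (suc t) ^ m)) k))

  -- Complex numbers and the action of polynomials on series

  data Part : Set where
    real imag : Part

  part : Part → ℂ → ℕ → ℚ
  part real z = seq (re z)
  part imag z = seq (im z)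

  infix 4 _≐_

  -- Equality of the representing sequences. All the algebra below holds at this level, so each
  -- identity over ℂ is checked in ℚ.
  _≐_ : ℂ → ℂ → Set
  z ≐ w = ∀ p N → part p z N ≡ part p w N

  ≈ʳ-from-≡ : ∀ {x y} → (∀ N → seq x N ≡ seq y N) → x ≈ʳ y
  ≈ʳ-from-≡ {x} {y} e = mk≈ʳ λ ε 0<ε → 0 , λ N _ →
    subst (_< ε) (sym (cong ∣_∣ (trans (cong (_- seq y N) (e N)) (ℚₚ.+-inverseʳ (seq y N))))) 0<ε

  ≐⇒≈ᶜ : ∀ {z w} → z ≐ w → z ≈ᶜ w
  ≐⇒≈ᶜ e = mk≈ᶜ (≈ʳ-from-≡ (e real)) (≈ʳ-from-≡ (e imag))

  part-+ : ∀ p z w N → part p (z +ᶜ w) N ≡ part p z N + part p w N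
  part-+ real z w N = refl
  part-+ imag z w N = refl

  part-0 : ∀ p N → part p 0ᶜ N ≡ 0ℚ
  part-0 real N = refl
  part-0 imag N = refl

  part-- : ∀ p z w N → part p (z -ᶜ w) N ≡ part p z N - part p w N
  part-- real z w N = refl
  part-- imag z w N = refl

  part-*-ℚ : ∀ p z q N → part p (z *ᶜ ℚ→ℂ q) N ≡ part p z N * q
  part-*-ℚ real z q N = simplify (seq (re z) N) (seq (im z) N) q
    where
    simplify : ∀ x y q → x * q + - (y * 0ℚ) ≡ x * q
    simplify = solve-∀ ring
  part-*-ℚ imag z q N = simplify (seq (re z) N) (seq (im z) N) q
    where
    simplify : ∀ x y q → x * 0ℚ + y * q ≡ y * q
    simplify = solve-∀ ring

  part-*-ℕ : ∀ p z k N → part p (z *ᶜ ℕ→ℂ k) N ≡ part p z N * ι k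
  part-*-ℕ real z k N = part-*-ℚ real z (ι k) N
  part-*-ℕ imag z k N = part-*-ℚ imag z (ι k) N

  part-ℚ-* : ∀ p z q N → part p (ℚ→ℂ q *ᶜ z) N ≡ q * part p z N
  part-ℚ-* real z q N = simplify (seq (re z) N) (seq (im z) N) q
    where
    simplify : ∀ x y q → q * x + - (0ℚ * y) ≡ q * x
    simplify = solve-∀ ring
  part-ℚ-* imag z q N = simplify (seq (re z) N) (seq (im z) N) q
    where
    simplify : ∀ x y q → q * y + 0ℚ * x ≡ q * y
    simplify = solve-∀ ring

  part-0-* : ∀ p z N → part p (0ᶜ *ᶜ z) N ≡ 0ℚ
  part-0-* real z N = simplify (seq (re z) N) (seq (im z) N)
    where
    simplify : ∀ x y → 0ℚ * x + - (0ℚ * y) ≡ 0ℚ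
    simplify = solve-∀ ring
  part-0-* imag z N = simplify (seq (re z) N) (seq (im z) N)
    where
    simplify : ∀ x y → 0ℚ * y + 0ℚ * x ≡ 0ℚ
    simplify = solve-∀ ring

  part-1-* : ∀ p z N → part p (1ᶜ *ᶜ z) N ≡ part p z N
  part-1-* real z N = simplify (seq (re z) N) (seq (im z) N)
    where
    simplify : ∀ x y → 1ℚ * x + - (0ℚ * y) ≡ x
    simplify = solve-∀ ring
  part-1-* imag z N = simplify (seq (re z) N) (seq (im z) N)
    where
    simplify : ∀ x y → 1ℚ * y + 0ℚ * x ≡ y
    simplify = solve-∀ ring

  part-neg1-* : ∀ p z N → part p ((-ᶜ 1ᶜ) *ᶜ z) N ≡ - part p z N
  part-neg1-* real z N = simplify (seq (re z) N) (seq (im z) N)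
    where
    simplify : ∀ x y → - 1ℚ * x + - (- 0ℚ * y) ≡ - x
    simplify = solve-∀ ring
  part-neg1-* imag z N = simplify (seq (re z) N) (seq (im z) N)
    where
    simplify : ∀ x y → - 1ℚ * y + - 0ℚ * x ≡ - y
    simplify = solve-∀ ring

  -- The linear form in h with rational weights `v`. At a fixed part and approximation index it
  -- becomes `dot`, a linear form over ℚ.
  combination : ∀ {m} → Vec ℂ m → (ℕ → ℚ) → ℂ
  combination []      v = 0ᶜ
  combination (c ∷ h) v = c *ᶜ ℚ→ℂ (v 0) +ᶜ combination h (v ∘ suc)

  dot : ∀ {m} → Vec ℚ m → (ℕ → ℚ) → ℚ
  dot []      v = 0ℚ
  dot (c ∷ h) v = c * v 0 + dot h (v ∘ suc)

  part-combination : ∀ {m} p (h : Vec ℂ m) v N →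
    part p (combination h v) N ≡ dot (Vec.map (λ c → part p c N) h) v
  part-combination p []      v N = part-0 p N
  part-combination p (c ∷ h) v N = trans (part-+ p (c *ᶜ ℚ→ℂ (v 0)) (combination h (v ∘ suc)) N)
    (cong₂ _+_ (part-*-ℚ p c (v 0) N) (part-combination p h (v ∘ suc) N))

  dot-cong : ∀ {m} (h : Vec ℚ m) {v w} → (∀ l → l ℕ.< m → v l ≡ w l) → dot h v ≡ dot h w
  dot-cong []      e = refl
  dot-cong (c ∷ h) e = cong₂ _+_ (cong (λ x → c * x) (e 0 (s≤s z≤n))) (dot-cong h (λ l l<m → e (suc l) (s≤s l<m)))

  dot-linear : ∀ {m} (h : Vec ℚ m) α v β w →
    dot h (λ l → α * v l + β * w l) ≡ α * dot h v + β * dot h w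
  dot-linear []      α v β w = zeros α β
    where
    zeros : ∀ α β → 0ℚ ≡ α * 0ℚ + β * 0ℚ
    zeros = solve-∀ ring
  dot-linear (c ∷ h) α v β w = trans (cong (λ x → c * (α * v 0 + β * w 0) + x) (dot-linear h α (v ∘ suc) β (w ∘ suc)))
    (rearrange c α (v 0) (dot h (v ∘ suc)) β (w 0) (dot h (w ∘ suc)))
    where
    rearrange : ∀ c α x s β y t → c * (α * x + β * y) + (α * s + β * t) ≡ α * (c * x + s) + β * (c * y + t)
    rearrange = solve-∀ ring

  dot-0 : ∀ {m} (h : Vec ℚ m) → dot h (λ _ → 0ℚ) ≡ 0ℚ
  dot-0 []      = refl
  dot-0 (c ∷ h) = cong₂ _+_ (ℚₚ.*-zeroʳ c) (dot-0 h)

  dot-sub : ∀ {m} (h : Vec ℚ m) v w → dot h v - dot h w ≡ dot h (λ l → v l - w l)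
  dot-sub h v w = begin
    dot h v - dot h w                           ≡⟨ expand (dot h v) (dot h w) ⟩
    1ℚ * dot h v + - 1ℚ * dot h w               ≡⟨ dot-linear h 1ℚ v (- 1ℚ) w ⟨
    dot h (λ l → 1ℚ * v l + - 1ℚ * w l)         ≡⟨ dot-cong h (λ l _ → sym (expand (v l) (w l))) ⟩
    dot h (λ l → v l - w l)                     ∎
    where
    open ≡-Reasoning
    expand : ∀ x y → x - y ≡ 1ℚ * x + - 1ℚ * y
    expand = solve-∀ ring

  combination-cong : ∀ {m} (h : Vec ℂ m) {v w} → (∀ l → l ℕ.< m → v l ≡ w l) → combination h v ≐ combination h w
  combination-cong h {v} {w} e p N = trans (part-combination p h v N)
    (trans (dot-cong (Vec.map (λ c → part p c N) h) e) (sym (part-combination p h w N)))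

  combination-0 : ∀ {m} (h : Vec ℂ m) {v} → (∀ l → l ℕ.< m → v l ≡ 0ℚ) → combination h v ≐ 0ᶜ
  combination-0 h {v} e p N = trans (part-combination p h v N)
    (trans (dot-cong (Vec.map (λ c → part p c N) h) e)
      (trans (dot-0 (Vec.map (λ c → part p c N) h)) (sym (part-0 p N))))

  dot-mono : ∀ {m} p (h : Vec ℂ m) i N →
    dot (Vec.map (λ c → part p c N) h) (λ l → mono l i) ≡ part p (coeff (toList h) i) N
  dot-mono p []      i       N = sym (part-0 p N)
  dot-mono p (c ∷ h) zero    N = trans
    (cong₂ _+_ (ℚₚ.*-identityʳ (part p c N)) (dot-0 (Vec.map (λ c → part p c N) h)))
    (ℚₚ.+-identityʳ (part p c N))
  dot-mono p (c ∷ h) (suc i) N = trans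
    (cong₂ _+_ (ℚₚ.*-zeroʳ (part p c N)) (dot-mono p h i N))
    (ℚₚ.+-identityˡ (part p (coeff (toList h) i) N))

  combination-mono : ∀ {m} (h : Vec ℂ m) i → combination h (λ l → mono l i) ≐ coeff (toList h) i
  combination-mono h i p N = trans (part-combination p h (λ l → mono l i) N) (dot-mono p h i N)

  part-eval-1 : ∀ {m} p (h : Vec ℂ m) N →
    part p (eval (toList h) 1ᶜ) N ≡ dot (Vec.map (λ c → part p c N) h) (λ _ → 1ℚ)
  part-eval-1 p []      N = part-0 p N
  part-eval-1 p (c ∷ h) N = trans (part-+ p c (1ᶜ *ᶜ eval (toList h) 1ᶜ) N)
    (cong₂ _+_ (sym (ℚₚ.*-identityʳ (part p c N)))
      (trans (part-1-* p (eval (toList h) 1ᶜ) N) (part-eval-1 p h N)))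

  -- Multiplication of Laurent series by polynomials

  +ᵖ-· : ∀ P Q a k p N → part p (((P +ᵖ Q) · a) k) N ≡ part p ((P · a) k) N + part p ((Q · a) k) N
  +ᵖ-· []      Q       a k p N = sym (trans (cong (_+ part p ((Q · a) k) N) (part-0 p N)) (ℚₚ.+-identityˡ _))
  +ᵖ-· (c ∷ P) []      a k p N = sym (trans (cong (λ x → part p (((c ∷ P) · a) k) N + x) (part-0 p N))
    (ℚₚ.+-identityʳ _))
  +ᵖ-· (c ∷ P) (d ∷ Q) a k real N = trans
    (cong (λ t → (C₁ + D₁) * A₁ + - ((C₂ + D₂) * A₂) + t) (+ᵖ-· P Q a (k ℤ.- ℤ.+ 1) real N))
    (rearrange C₁ C₂ D₁ D₂ A₁ A₂ (seq (re ((P · a) (k ℤ.- ℤ.+ 1))) N) (seq (re ((Q · a) (k ℤ.- ℤ.+ 1))) N))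
    where
    C₁ = seq (re c) N
    C₂ = seq (im c) N
    D₁ = seq (re d) N
    D₂ = seq (im d) N
    A₁ = seq (re (a k)) N
    A₂ = seq (im (a k)) N
    rearrange : ∀ c₁ c₂ d₁ d₂ a₁ a₂ s t →
      (c₁ + d₁) * a₁ + - ((c₂ + d₂) * a₂) + (s + t)
        ≡ (c₁ * a₁ + - (c₂ * a₂) + s) + (d₁ * a₁ + - (d₂ * a₂) + t)
    rearrange = solve-∀ ring
  +ᵖ-· (c ∷ P) (d ∷ Q) a k imag N = trans
    (cong (λ t → (C₁ + D₁) * A₂ + (C₂ + D₂) * A₁ + t) (+ᵖ-· P Q a (k ℤ.- ℤ.+ 1) imag N))
    (rearrange C₁ C₂ D₁ D₂ A₁ A₂ (seq (im ((P · a) (k ℤ.- ℤ.+ 1))) N) (seq (im ((Q · a) (k ℤ.- ℤ.+ 1))) N))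
    where
    C₁ = seq (re c) N
    C₂ = seq (im c) N
    D₁ = seq (re d) N
    D₂ = seq (im d) N
    A₁ = seq (re (a k)) N
    A₂ = seq (im (a k)) N
    rearrange : ∀ c₁ c₂ d₁ d₂ a₁ a₂ s t →
      (c₁ + d₁) * a₂ + (c₂ + d₂) * a₁ + (s + t)
        ≡ (c₁ * a₂ + c₂ * a₁ + s) + (d₁ * a₂ + d₂ * a₁ + t)
    rearrange = solve-∀ ring

  •-· : ∀ z P a k → ((z • P) · a) k ≐ z *ᶜ (P · a) k
  •-· z []      a k real N = zeros (seq (re z) N) (seq (im z) N)
    where
    zeros : ∀ x y → 0ℚ ≡ x * 0ℚ + - (y * 0ℚ)
    zeros = solve-∀ ring
  •-· z []      a k imag N = zeros (seq (re z) N) (seq (im z) N)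
    where
    zeros : ∀ x y → 0ℚ ≡ x * 0ℚ + y * 0ℚ
    zeros = solve-∀ ring
  •-· z (c ∷ P) a k real N = trans
    (cong (λ t → (seq (re z) N * seq (re c) N + - (seq (im z) N * seq (im c) N)) * seq (re (a k)) N
      + - ((seq (re z) N * seq (im c) N + seq (im z) N * seq (re c) N) * seq (im (a k)) N) + t)
      (•-· z P a (k ℤ.- ℤ.+ 1) real N))
    (rearrange (seq (re z) N) (seq (im z) N) (seq (re c) N) (seq (im c) N) (seq (re (a k)) N) (seq (im (a k)) N)
      (seq (re ((P · a) (k ℤ.- ℤ.+ 1))) N) (seq (im ((P · a) (k ℤ.- ℤ.+ 1))) N))
    where
    rearrange : ∀ z₁ z₂ c₁ c₂ a₁ a₂ s t →
      (z₁ * c₁ + - (z₂ * c₂)) * a₁ + - ((z₁ * c₂ + z₂ * c₁) * a₂) + (z₁ * s + - (z₂ * t))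
        ≡ z₁ * (c₁ * a₁ + - (c₂ * a₂) + s) + - (z₂ * (c₁ * a₂ + c₂ * a₁ + t))
    rearrange = solve-∀ ring
  •-· z (c ∷ P) a k imag N = trans
    (cong (λ t → (seq (re z) N * seq (re c) N + - (seq (im z) N * seq (im c) N)) * seq (im (a k)) N
      + (seq (re z) N * seq (im c) N + seq (im z) N * seq (re c) N) * seq (re (a k)) N + t)
      (•-· z P a (k ℤ.- ℤ.+ 1) imag N))
    (rearrange (seq (re z) N) (seq (im z) N) (seq (re c) N) (seq (im c) N) (seq (re (a k)) N) (seq (im (a k)) N)
      (seq (re ((P · a) (k ℤ.- ℤ.+ 1))) N) (seq (im ((P · a) (k ℤ.- ℤ.+ 1))) N))
    where
    rearrange : ∀ z₁ z₂ c₁ c₂ a₁ a₂ s t →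
      (z₁ * c₁ + - (z₂ * c₂)) * a₂ + (z₁ * c₂ + z₂ * c₁) * a₁ + (z₁ * t + z₂ * s)
        ≡ z₁ * (c₁ * a₂ + c₂ * a₁ + t) + z₂ * (c₁ * a₁ + - (c₂ * a₂) + s)
    rearrange = solve-∀ ring

  0∷-· : ∀ P a k → ((0ᶜ ∷ P) · a) k ≐ (P · a) (k ℤ.- ℤ.+ 1)
  0∷-· P a k p N = trans (part-+ p (0ᶜ *ᶜ a k) ((P · a) (k ℤ.- ℤ.+ 1)) N)
    (trans (cong (_+ part p ((P · a) (k ℤ.- ℤ.+ 1)) N) (part-0-* p (a k) N))
           (ℚₚ.+-identityˡ _))

  1-x-· : ∀ P a k p N →
    part p (((1-x *ᵖ P) · a) k) N ≡ part p ((P · a) k) N - part p ((P · a) (k ℤ.- ℤ.+ 1)) N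
  1-x-· P a k p N = begin
    part p ((((1ᶜ • P) +ᵖ (0ᶜ ∷ Q)) · a) k) N
      ≡⟨ +ᵖ-· (1ᶜ • P) (0ᶜ ∷ Q) a k p N ⟩
    part p (((1ᶜ • P) · a) k) N + part p (((0ᶜ ∷ Q) · a) k) N
      ≡⟨ cong₂ _+_ first second ⟩
    part p ((P · a) k) N - part p ((P · a) k-1) N ∎
    where
    open ≡-Reasoning
    k-1 = k ℤ.- ℤ.+ 1
    -- The product of the constant polynomial -1 and `P`, unfolded; `0ᶜ ∷ []` is the trailing zero
    -- left by the recursion of `*ᵖ`.
    Q = ((-ᶜ 1ᶜ) • P) +ᵖ (0ᶜ ∷ [])
    first : part p (((1ᶜ • P) · a) k) N ≡ part p ((P · a) k) N
    first = trans (•-· 1ᶜ P a k p N) (part-1-* p ((P · a) k) N)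
    second : part p (((0ᶜ ∷ Q) · a) k) N ≡ - part p ((P · a) k-1) N
    second = begin
      part p (((0ᶜ ∷ Q) · a) k) N
        ≡⟨ 0∷-· Q a k p N ⟩
      part p ((Q · a) k-1) N
        ≡⟨ +ᵖ-· ((-ᶜ 1ᶜ) • P) (0ᶜ ∷ []) a k-1 p N ⟩
      part p ((((-ᶜ 1ᶜ) • P) · a) k-1) N + part p (((0ᶜ ∷ []) · a) k-1) N
        ≡⟨ cong₂ _+_ (trans (•-· (-ᶜ 1ᶜ) P a k-1 p N) (part-neg1-* p ((P · a) k-1) N))
                     (trans (0∷-· [] a k-1 p N) (part-0 p N)) ⟩
      - part p ((P · a) k-1) N + 0ℚ
        ≡⟨ ℚₚ.+-identityʳ (- part p ((P · a) k-1) N) ⟩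
      - part p ((P · a) k-1) N ∎

  fromℕ : (ℕ → ℂ) → Series
  fromℕ s (ℤ.+ k)  = s k
  fromℕ s -[1+ k ] = 0ᶜ

  -- Extension by zero to negative indices is the convention s (-1) = 0 of `D`, which is what the
  -- case k = 0 checks.
  extended-difference : ∀ {m} (h : Vec ℂ m) (v : ℕ → ℕ → ℚ) k p N →
    part p (fromℕ (λ k → combination h (λ l → v l k)) k) N
      - part p (fromℕ (λ k → combination h (λ l → v l k)) (k ℤ.- ℤ.+ 1)) N
      ≡ part p (fromℕ (λ k → combination h (λ l → D (v l) k)) k) N
  extended-difference h v (ℤ.+ zero) p N = trans
    (cong (λ x → part p (combination h (λ l → v l 0)) N - x) (part-0 p N))
    (ℚₚ.+-identityʳ (part p (combination h (λ l → v l 0)) N))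
  extended-difference h v (ℤ.+ suc k) p N = begin
    part p (combination h (λ l → v l (suc k))) N - part p (combination h (λ l → v l k)) N
      ≡⟨ cong₂ _-_ (part-combination p h (λ l → v l (suc k)) N) (part-combination p h (λ l → v l k) N) ⟩
    dot H (λ l → v l (suc k)) - dot H (λ l → v l k)
      ≡⟨ dot-sub H (λ l → v l (suc k)) (λ l → v l k) ⟩
    dot H (λ l → D (v l) (suc k))
      ≡⟨ part-combination p h (λ l → D (v l) (suc k)) N ⟨
    part p (combination h (λ l → D (v l) (suc k))) N ∎
    where
    open ≡-Reasoning
    H = Vec.map (λ c → part p c N) h
  extended-difference h v -[1+ k ] p N = trans (cong₂ _-_ (part-0 p N) (part-0 p N)) (sym (part-0 p N))

  1-· : ∀ a k → ((1-x ^ᵖ 0) · a) k ≐ a k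
  1-· a k real N = simplify (seq (re (a k)) N) (seq (im (a k)) N)
    where
    simplify : ∀ x y → 1ℚ * x + - (0ℚ * y) + 0ℚ ≡ x
    simplify = solve-∀ ring
  1-· a k imag N = simplify (seq (re (a k)) N) (seq (im (a k)) N)
    where
    simplify : ∀ x y → 1ℚ * y + 0ℚ * x + 0ℚ ≡ y
    simplify = solve-∀ ring

  -- The series `a` is given by pointwise equations because an iterate of Φ agrees only pointwise
  -- with a series of the form `fromℕ`.
  1-x^-· : ∀ {m} (h : Vec ℂ m) n (v : ℕ → ℕ → ℚ) (a : Series) →
    (∀ k → a k ≡ fromℕ (λ k → combination h (λ l → v l k)) k) → ∀ k →
    ((1-x ^ᵖ n) · a) k ≐ fromℕ (λ k → combination h (λ l → D^ n (v l) k)) k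
  1-x^-· h zero    v a a≡ k p N = trans (1-· a k p N) (cong (λ z → part p z N) (a≡ k))
  1-x^-· h (suc n) v a a≡ k p N = trans (1-x-· (1-x ^ᵖ n) a k p N)
    (trans (cong₂ _-_ (1-x^-· h n v a a≡ k p N) (1-x^-· h n v a a≡ (k ℤ.- ℤ.+ 1) p N))
           (extended-difference h (λ l → D^ n (v l)) k p N))

  -- Expansions and convergence

  Φ-index : ∀ b n → b ℤ.* n ℤ.+ (b ℤ.- ℤ.+ 1) ≡ b ℤ.* (n ℤ.+ ℤ.+ 1) ℤ.- ℤ.+ 1
  Φ-index = ℤ-RingSolver.solve-∀

  fromℕ-cong : ∀ {s t} → s ≗ t → fromℕ s ≗ fromℕ t
  fromℕ-cong e (ℤ.+ k)  = e k
  fromℕ-cong e -[1+ k ] = refl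

  Φ-fromℕ : ∀ b .{{_ : ℕ.NonZero b}} (s : ℕ → ℂ) →
    Φ b (fromℕ (s ∘ suc)) ≗ fromℕ (λ k → s (b ℕ.* suc k))
  Φ-fromℕ b@(suc b-1) s (ℤ.+ k) = cong (fromℕ (s ∘ suc)) (begin
    ℤ.+ b ℤ.* ℤ.+ k ℤ.+ (ℤ.+ b ℤ.- ℤ.+ 1)    ≡⟨ Φ-index (ℤ.+ b) (ℤ.+ k) ⟩
    ℤ.+ b ℤ.* ℤ.+ (k ℕ.+ 1) ℤ.- ℤ.+ 1        ≡⟨ cong (λ j → ℤ.+ b ℤ.* ℤ.+ j ℤ.- ℤ.+ 1) (ℕₚ.+-comm k 1) ⟩
    ℤ.+ b ℤ.* ℤ.+ suc k ℤ.- ℤ.+ 1            ≡⟨ cong (ℤ._- ℤ.+ 1) (ℤₚ.pos-* b (suc k)) ⟨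
    ℤ.+ (k ℕ.+ b-1 ℕ.* suc k)                ∎)
    where open ≡-Reasoning
  -- Here n + 1 = -k, so the index b (n + 1) - 1 is negative again and both sides are zero.
  Φ-fromℕ b s -[1+ k ] = cong (fromℕ (s ∘ suc)) (begin
    ℤ.+ b ℤ.* -[1+ k ] ℤ.+ (ℤ.+ b ℤ.- ℤ.+ 1)    ≡⟨ Φ-index (ℤ.+ b) -[1+ k ] ⟩
    ℤ.+ b ℤ.* (-[1+ k ] ℤ.+ ℤ.+ 1) ℤ.- ℤ.+ 1    ≡⟨ cong (λ j → ℤ.+ b ℤ.* j ℤ.- ℤ.+ 1) (suc-neg k) ⟩
    ℤ.+ b ℤ.* (ℤ.- (ℤ.+ k)) ℤ.- ℤ.+ 1           ≡⟨ cong (ℤ._- ℤ.+ 1) (ℤₚ.neg-distribʳ-* (ℤ.+ b) (ℤ.+ k)) ⟨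
    ℤ.- (ℤ.+ b ℤ.* ℤ.+ k) ℤ.- ℤ.+ 1             ≡⟨ cong (λ j → ℤ.- j ℤ.- ℤ.+ 1) (ℤₚ.pos-* b k) ⟨
    ℤ.- (ℤ.+ (b ℕ.* k)) ℤ.- ℤ.+ 1               ≡⟨ neg-pred (b ℕ.* k) ⟩
    -[1+ b ℕ.* k ]                              ∎)
    where
    open ≡-Reasoning
    suc-neg : ∀ k → -[1+ k ] ℤ.+ ℤ.+ 1 ≡ ℤ.- (ℤ.+ k)
    suc-neg zero    = refl
    suc-neg (suc k) = refl
    neg-pred : ∀ k → ℤ.- (ℤ.+ k) ℤ.- ℤ.+ 1 ≡ -[1+ k ]
    neg-pred zero    = refl
    neg-pred (suc k) = cong (λ j → -[1+ suc j ]) (ℕₚ.+-identityʳ k)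

  -- Shifting the exponents by one turns Φ b into the dilation t ↦ b t.
  Φ^-fromℕ : ∀ b .{{_ : ℕ.NonZero b}} r (s : ℕ → ℂ) →
    Φ^ b r (fromℕ (s ∘ suc)) ≗ fromℕ (λ k → s (b ℕ.^ r ℕ.* suc k))
  Φ^-fromℕ b zero    s k = fromℕ-cong (λ k → cong s (sym (ℕₚ.*-identityˡ (suc k)))) k
  Φ^-fromℕ b (suc r) s k = trans (Φ^-fromℕ b r s _) (trans (Φ-fromℕ b (λ t → s (b ℕ.^ r ℕ.* t)) k)
    (fromℕ-cong (λ k → cong s (trans (sym (ℕₚ.*-assoc (b ℕ.^ r) b (suc k)))
                                     (cong (ℕ._* suc k) (ℕₚ.*-comm (b ℕ.^ r) b)))) k))

  ≡⇒≐ : ∀ {z w} → z ≡ w → z ≐ w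
  ≡⇒≐ refl p N = refl

  coeff-applyUpTo : ∀ f {m i} → i ℕ.< m → coeff (applyUpTo f m) i ≡ f i
  coeff-applyUpTo f {suc m} {zero}  _         = refl
  coeff-applyUpTo f {suc m} {suc i} (s≤s i<m) = coeff-applyUpTo (f ∘ suc) i<m

  coeff-applyUpTo-≥ : ∀ f {m i} → m ℕ.≤ i → coeff (applyUpTo f m) i ≡ 0ᶜ
  coeff-applyUpTo-≥ f {zero}          _         = refl
  coeff-applyUpTo-≥ f {suc m} {suc i} (s≤s m≤i) = coeff-applyUpTo-≥ (f ∘ suc) m≤i

  •-applyUpTo : ∀ z f m → z • applyUpTo f m ≡ applyUpTo (λ i → z *ᶜ f i) m
  •-applyUpTo z f m = Listₚ.map-applyUpTo f (z *ᶜ_) m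

  toList-tabulate : ∀ (f : ℕ → ℂ) m → toList (tabulate {n = m} (f ∘ toℕ)) ≡ applyUpTo f m
  toList-tabulate f zero    = refl
  toList-tabulate f (suc m) = cong (f 0 ∷_) (toList-tabulate (f ∘ suc) m)

  ≈ᶜ-refl : ∀ z → z ≈ᶜ z
  ≈ᶜ-refl z = mk≈ᶜ (≈ʳ-from-≡ (λ _ → refl)) (≈ʳ-from-≡ (λ _ → refl))

  num≡⇒≃ : ∀ R S → num R ≡ num S → den R ≡ den S → R ≃ S
  num≡⇒≃ (P / d ⟨ _ ⟩) (_ / _ ⟨ _ ⟩) refl refl i = ≈ᶜ-refl (coeff (P *ᵖ d) i)

  -- Bounds and limits of complex sequences

  Bounded : (ℕ → ℚ) → Set
  Bounded x = Σ[ B ∈ ℚ ] (0ℚ ≤ B × (Σ[ M ∈ ℕ ] (∀ N → M ℕ.≤ N → ∣ x N ∣ ≤ B)))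

  cauchy⇒bounded : ∀ x → IsCauchy x → Bounded x
  cauchy⇒bounded x cx with cx 1ℚ (ℚₚ.positive⁻¹ 1ℚ)
  ... | M , near = 1ℚ + ∣ x M ∣ , ℚₚ.+-mono-≤ (ℚₚ.nonNegative⁻¹ 1ℚ) (ℚₚ.0≤∣p∣ (x M)) , M , λ N M≤N → begin
      ∣ x N ∣                    ≡⟨ cong ∣_∣ (split (x N) (x M)) ⟩
      ∣ (x N - x M) + x M ∣      ≤⟨ ℚₚ.∣p+q∣≤∣p∣+∣q∣ (x N - x M) (x M) ⟩
      ∣ x N - x M ∣ + ∣ x M ∣    ≤⟨ ℚₚ.+-monoˡ-≤ ∣ x M ∣ (ℚₚ.<⇒≤ (near N M M≤N ℕₚ.≤-refl)) ⟩
      1ℚ + ∣ x M ∣               ∎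
    where
    open ℚₚ.≤-Reasoning
    split : ∀ a b → a ≡ (a - b) + b
    split = solve-∀ ring

  bounded : ∀ p z → Bounded (part p z)
  bounded real z = cauchy⇒bounded (seq (re z)) (cauchy (re z))
  bounded imag z = cauchy⇒bounded (seq (im z)) (cauchy (im z))

  -- Archimedean property: denominators are at least 1, so a nonnegative rational is bounded by its
  -- numerator.
  ≤ι : ∀ q → Σ[ R ∈ ℕ ] q ≤ ι R
  ≤ι q@(mkℚ (ℤ.+ n) d-1 _) = n , ℚₚ.toℚᵘ-cancel-≤ (ℚᵘₚ.≤-trans
    (ℚᵘ.*≤* (subst₂ ℤ._≤_ (sym (ℤₚ.*-identityʳ (ℤ.+ n))) (ℤₚ.pos-* n (suc d-1)) (ℤ.+≤+ (ℕₚ.m≤m*n n (suc d-1)))))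
    (ℚᵘₚ.≤-reflexive (ℚᵘₚ.≃-sym (ι≃ n))))
  ≤ι q@(mkℚ -[1+ n ] d-1 _) = 0 , ℚₚ.nonPositive⁻¹ q

  r≤b^r : ∀ b .{{_ : ℕ.NonTrivial b}} r → r ℕ.≤ b ℕ.^ r
  r≤b^r b r = ℕₚ.<⇒≤ (r<b^r r)
    where
    r<b^r : ∀ r → r ℕ.< b ℕ.^ r
    r<b^r zero    = s≤s z≤n
    r<b^r (suc r) = begin
      2 ℕ.+ r                      ≤⟨ s≤s (ℕₚ.m≤n+m (suc r) r) ⟩
      suc r ℕ.+ suc r              ≡⟨ cong (suc r ℕ.+_) (ℕₚ.+-identityʳ (suc r)) ⟨
      2 ℕ.* suc r                  ≤⟨ ℕₚ.*-mono-≤ (ℕ.nonTrivial⇒n>1 b) (r<b^r r) ⟩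
      b ℕ.* b ℕ.^ r                ∎
      where open ℕₚ.≤-Reasoning

  square-mono : ∀ x y → ∣ x ∣ ≤ y → x * x ≤ y * y
  square-mono x y ∣x∣≤y = begin
    x * x          ≡⟨ square-∣∣ ⟩
    ∣ x ∣ * ∣ x ∣  ≤⟨ ℚₚ.*-monoˡ-≤-nonNeg ∣ x ∣ {{ℚₚ.∣-∣-nonNeg x}} ∣x∣≤y ⟩
    ∣ x ∣ * y      ≤⟨ ℚₚ.*-monoʳ-≤-nonNeg y {{ℚ.nonNegative (ℚₚ.≤-trans (ℚₚ.0≤∣p∣ x) ∣x∣≤y)}} ∣x∣≤y ⟩
    y * y          ∎
    where
    open ℚₚ.≤-Reasoning
    neg-square : ∀ x → x * x ≡ - x * - x
    neg-square = solve-∀ ring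
    square-∣∣ : x * x ≡ ∣ x ∣ * ∣ x ∣
    square-∣∣ with ℚₚ.∣p∣≡p∨∣p∣≡-p x
    ... | inj₁ e = sym (cong₂ _*_ e e)
    ... | inj₂ e = trans (neg-square x) (sym (cong₂ _*_ e e))

  parts-small⇒⟶ : ∀ (z : ℕ → ℂ) w →
    (∀ p η → 0ℚ < η → Σ[ R ∈ ℕ ] Σ[ M ∈ ℕ ]
      (∀ r → R ℕ.≤ r → ∀ N → M ℕ.≤ N → ∣ part p (z r -ᶜ w) N ∣ ≤ η)) → z ⟶ᶜ w
  parts-small⇒⟶ z w small ε 0<ε = go (small real η 0<η) (small imag η 0<η)
    where
    open ℚₚ.≤-Reasoning
    -- Two squares of parts use up 2 η² of ε² = 4 η²; a further η² serves as the gap that `<ʳ`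
    -- demands.
    η = ½ * ε
    0<η : 0ℚ < η
    0<η = ℚₚ.*-monoʳ-<-pos ½ 0<ε
    0<η² : 0ℚ < η * η
    0<η² = ℚₚ.positive⁻¹ (η * η) {{ℚₚ.pos*pos⇒pos η {{positive 0<η}} η {{positive 0<η}}}}
    quarter : ∀ c e → c * e * (c * e) + c * e * (c * e) + c * e * (c * e) + c * e * (c * e)
      ≡ (c * c + c * c + c * c + c * c) * (e * e)
    quarter = solve-∀ ring
    three-quarters : ∀ x y → ∣ x ∣ ≤ η → ∣ y ∣ ≤ η → x * x + y * y + η * η ≤ ε * ε
    three-quarters x y ∣x∣≤η ∣y∣≤η = begin
      x * x + y * y + η * η              ≤⟨ ℚₚ.+-monoˡ-≤ (η * η) (ℚₚ.+-mono-≤ (square-mono x η ∣x∣≤η) (square-mono y η ∣y∣≤η)) ⟩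
      η * η + η * η + η * η              ≡⟨ ℚₚ.+-identityʳ (η * η + η * η + η * η) ⟨
      η * η + η * η + η * η + 0ℚ         ≤⟨ ℚₚ.+-monoʳ-≤ (η * η + η * η + η * η) (ℚₚ.<⇒≤ 0<η²) ⟩
      η * η + η * η + η * η + η * η      ≡⟨ quarter ½ ε ⟩
      (½ * ½ + ½ * ½ + ½ * ½ + ½ * ½) * (ε * ε)  ≡⟨ ℚₚ.*-identityˡ (ε * ε) ⟩
      ε * ε                              ∎
    Small : Part → Set
    Small p = Σ[ R ∈ ℕ ] Σ[ M ∈ ℕ ] (∀ r → R ℕ.≤ r → ∀ N → M ℕ.≤ N → ∣ part p (z r -ᶜ w) N ∣ ≤ η)
    go : Small real → Small imag → Σ[ R ∈ ℕ ] (∀ r → R ℕ.≤ r → ∣ z r -ᶜ w ∣² <ʳ fromℚ (ε * ε))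
    go (R , M , x≤η) (R′ , M′ , y≤η) = R ℕ.⊔ R′ , λ r R⊔R′≤r → mk<ʳ (η * η) 0<η² (M ℕ.⊔ M′) λ N M⊔M′≤N →
      three-quarters (part real (z r -ᶜ w) N) (part imag (z r -ᶜ w) N)
        (x≤η r (ℕₚ.m⊔n≤o⇒m≤o R R′ R⊔R′≤r) N (ℕₚ.m⊔n≤o⇒m≤o M M′ M⊔M′≤N))
        (y≤η r (ℕₚ.m⊔n≤o⇒n≤o R R′ R⊔R′≤r) N (ℕₚ.m⊔n≤o⇒n≤o M M′ M⊔M′≤N))

  module Convergence (b : ℕ) .{{_ : ℕ.NonTrivial b}} where
    open Dilation b public

    -- It suffices that R ≥ K / η, for then b^r ≥ r ≥ K / η. The growth b^r ≥ r comes from b ≥ 2.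
    Kδ-small : ∀ K → 0ℚ ≤ K → ∀ η → 0ℚ < η → Σ[ R ∈ ℕ ] (∀ r → R ℕ.≤ r → K * δ r ≤ η)
    Kδ-small K 0≤K η 0<η = proj₁ large , λ r R≤r → begin
      K * δ r                        ≡⟨ cong (_* δ r) (trans (sym (ℚₚ.*-identityˡ K)) (cong (_* K) (sym (ℚₚ.*-inverseʳ η)))) ⟩
      η * 1/ η * K * δ r             ≡⟨ cong (_* δ r) (ℚₚ.*-assoc η (1/ η) K) ⟩
      η * (1/ η * K) * δ r           ≤⟨ ℚₚ.*-monoʳ-≤-nonNeg (δ r) {{ℚ.nonNegative (0≤δ r)}}
                                          (ℚₚ.*-monoˡ-≤-nonNeg η (ℚₚ.≤-trans (proj₂ large)
                                            (ι-mono-≤ (ℕₚ.≤-trans R≤r (r≤b^r b r))))) ⟩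
      η * ι (b ℕ.^ r) * δ r          ≡⟨ trans (ℚₚ.*-assoc η (ι (b ℕ.^ r)) (δ r)) (cong (η *_) (ι-δ r)) ⟩
      η * 1ℚ                         ≡⟨ ℚₚ.*-identityʳ η ⟩
      η                              ∎
      where
      open ℚₚ.≤-Reasoning
      instance
        η-positive : ℚ.Positive η
        η-positive = positive 0<η
        η-nonNegative : ℚ.NonNegative η
        η-nonNegative = ℚₚ.pos⇒nonNeg η
        η-nonZero : ℚ.NonZero η
        η-nonZero = ℚₚ.pos⇒nonZero η
      large = ≤ι (1/ η * K)

    -- `K` does not depend on the approximation index N, so the threshold for r can be chosen before
    -- N. `M` reflects that a Cauchy sequence is bounded by `K`-type constants only from some index
    -- on.
    UniformO : (ℕ → ℕ → ℚ) → Set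
    UniformO x = Σ[ K ∈ ℚ ] (0ℚ ≤ K × (Σ[ M ∈ ℕ ] (∀ N → M ℕ.≤ N → ∀ r → ∣ x N r ∣ ≤ K * δ r)))

    UniformO-*+ : ∀ x e y → Bounded x → O e → UniformO y → UniformO (λ N r → x N * e r + y N r)
    UniformO-*+ x e y (B , 0≤B , M , x≤B) (K , 0≤K , e≤K) (L , 0≤L , M′ , y≤L) =
      B * K + L
      , ℚₚ.+-mono-≤ (subst (_≤ B * K) (ℚₚ.*-zeroʳ B) (ℚₚ.*-monoˡ-≤-nonNeg B {{ℚ.nonNegative 0≤B}} 0≤K)) 0≤L
      , M ℕ.⊔ M′ , λ N M⊔M′≤N r → begin
        ∣ x N * e r + y N r ∣          ≤⟨ ℚₚ.∣p+q∣≤∣p∣+∣q∣ (x N * e r) (y N r) ⟩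
        ∣ x N * e r ∣ + ∣ y N r ∣      ≡⟨ cong (_+ ∣ y N r ∣) (ℚₚ.∣p*q∣≡∣p∣*∣q∣ (x N) (e r)) ⟩
        ∣ x N ∣ * ∣ e r ∣ + ∣ y N r ∣  ≤⟨ ℚₚ.+-mono-≤
            (ℚₚ.≤-trans
              (ℚₚ.*-monoʳ-≤-nonNeg ∣ e r ∣ {{ℚₚ.∣-∣-nonNeg (e r)}} (x≤B N (ℕₚ.m⊔n≤o⇒m≤o M M′ M⊔M′≤N)))
              (ℚₚ.*-monoˡ-≤-nonNeg B {{ℚ.nonNegative 0≤B}} (e≤K r)))
            (y≤L N (ℕₚ.m⊔n≤o⇒n≤o M M′ M⊔M′≤N) r) ⟩
        B * (K * δ r) + L * δ r        ≡⟨ rearrange B K L (δ r) ⟩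
        (B * K + L) * δ r              ∎
      where
      open ℚₚ.≤-Reasoning
      rearrange : ∀ b k l d → b * (k * d) + l * d ≡ (b * k + l) * d
      rearrange = solve-∀ ring

    dot-O : ∀ {m} p (h : Vec ℂ m) (e : ℕ → ℕ → ℚ) → (∀ l → l ℕ.< m → O (λ r → e r l)) →
      UniformO (λ N r → dot (Vec.map (λ c → part p c N) h) (e r))
    dot-O p []      e Oe = proj₁ O-0 , proj₁ (proj₂ O-0) , 0 , λ N _ r → proj₂ (proj₂ O-0) r
    dot-O p (c ∷ h) e Oe = UniformO-*+ (part p c) (λ r → e r 0)
      (λ N r → dot (Vec.map (λ c → part p c N) h) (e r ∘ suc))
      (bounded p c) (Oe 0 (s≤s z≤n)) (dot-O p h (λ r → e r ∘ suc) (λ l l<m → Oe (suc l) (s≤s l<m)))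

    -- The difference is a finite sum of coefficients of h, which are bounded, times rational errors
    -- of order δ.
    combination-⟶ : ∀ {m} (h : Vec ℂ m) (z : ℕ → ℂ) (w : ℂ) (e : ℕ → ℕ → ℚ) →
      (∀ r p N → part p (z r -ᶜ w) N ≡ dot (Vec.map (λ c → part p c N) h) (e r)) →
      (∀ l → l ℕ.< m → O (λ r → e r l)) → z ⟶ᶜ w
    combination-⟶ h z w e z-w≡ Oe = parts-small⇒⟶ z w (λ p η 0<η → small p η 0<η (dot-O p h e Oe))
      where
      small : ∀ p η → 0ℚ < η → UniformO (λ N r → dot (Vec.map (λ c → part p c N) h) (e r)) →
        Σ[ R ∈ ℕ ] Σ[ M ∈ ℕ ] (∀ r → R ℕ.≤ r → ∀ N → M ℕ.≤ N → ∣ part p (z r -ᶜ w) N ∣ ≤ η)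
      small p η 0<η (K , 0≤K , M , x≤) = proj₁ (Kδ-small K 0≤K η 0<η) , M , λ r R≤r N M≤N →
        ℚₚ.≤-trans (ℚₚ.≤-reflexive (cong ∣_∣ (z-w≡ r p N)))
          (ℚₚ.≤-trans (x≤ N M≤N r) (proj₂ (Kδ-small K 0≤K η 0<η) r R≤r))

  -- Numerators and their limits as linear forms in h

  negative⇒0 : ∀ s k → k ℤ.< ℤ.+ 0 → fromℕ s k ≡ 0ᶜ
  negative⇒0 s (ℤ.+ k)  (ℤ.+<+ ())
  negative⇒0 s -[1+ k ] _ = refl

  -- The limit is a linear form too, with the same weight f a on every coefficient; pulling this
  -- weight out leaves the sum of the coefficients, h(1).
  dot-combine : ∀ {m} (h : Vec ℚ m) c w f a →
    c * dot h w - f * (dot h (λ _ → 1ℚ) * a) ≡ dot h (λ l → c * w l - f * a)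
  dot-combine h c w f a = begin
    c * dot h w - f * (dot h (λ _ → 1ℚ) * a)
      ≡⟨ rearrange c (dot h w) f (dot h (λ _ → 1ℚ)) a ⟩
    c * dot h w + - (f * a) * dot h (λ _ → 1ℚ)
      ≡⟨ dot-linear h c w (- (f * a)) (λ _ → 1ℚ) ⟨
    dot h (λ l → c * w l + - (f * a) * 1ℚ)
      ≡⟨ dot-cong h (λ l _ → cong (λ x → c * w l + x) (ℚₚ.*-identityʳ (- (f * a)))) ⟩
    dot h (λ l → c * w l - f * a) ∎
    where
    open ≡-Reasoning
    rearrange : ∀ c x f y a → c * x - f * (y * a) ≡ c * x + - (f * a) * y
    rearrange = solve-∀ ring

  scaled : ∀ {m} → Vec ℂ m → ℚ → (ℕ → ℚ) → ℂ
  scaled h c w = ℚ→ℂ c *ᶜ combination h w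

  -- Bracketed like the numerator of the limit, where division by the factorial acts on the multiple
  -- h(1) of the Eulerian polynomial; the coefficients then coincide as terms.
  limitCoeff : ∀ {m} → Vec ℂ m → ℚ → ℕ → ℂ
  limitCoeff h f a = ℚ→ℂ f *ᶜ (eval (toList h) 1ᶜ *ᶜ ℕ→ℂ a)

  part-scaled : ∀ {m} (h : Vec ℂ m) c w p N →
    part p (scaled h c w) N ≡ c * dot (Vec.map (λ c → part p c N) h) w
  part-scaled h c w p N = trans (part-ℚ-* p (combination h w) c N) (cong (c *_) (part-combination p h w N))

  part-limitCoeff : ∀ {m} (h : Vec ℂ m) f a p N →
    part p (limitCoeff h f a) N ≡ f * (dot (Vec.map (λ c → part p c N) h) (λ _ → 1ℚ) * ι a)
  part-limitCoeff h f a p N = trans (part-ℚ-* p (eval (toList h) 1ᶜ *ᶜ ℕ→ℂ a) f N)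
    (cong (f *_) (trans (part-*-ℕ p (eval (toList h) 1ᶜ) a N) (cong (_* ι a) (part-eval-1 p h N))))

  part-difference : ∀ {m} (h : Vec ℂ m) c w f a p N → part p (scaled h c w -ᶜ limitCoeff h f a) N
    ≡ dot (Vec.map (λ c → part p c N) h) (λ l → c * w l - f * ι a)
  part-difference h c w f a p N = begin
    part p (scaled h c w -ᶜ limitCoeff h f a) N
      ≡⟨ part-- p (scaled h c w) (limitCoeff h f a) N ⟩
    part p (scaled h c w) N - part p (limitCoeff h f a) N
      ≡⟨ cong₂ _-_ (part-scaled h c w p N) (part-limitCoeff h f a p N) ⟩
    c * dot H w - f * (dot H (λ _ → 1ℚ) * ι a)
      ≡⟨ dot-combine H c w f (ι a) ⟩
    dot H (λ l → c * w l - f * ι a) ∎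
    where
    open ≡-Reasoning
    H = Vec.map (λ c → part p c N) h

  scaled-num : ∀ {m} (h : Vec ℂ m) c (w : ℕ → ℕ → ℚ) n →
    ℚ→ℂ c • applyUpTo (λ i → combination h (λ l → w l i)) n
      ≡ toList (tabulate {n = n} (λ i → scaled h c (λ l → w l (toℕ i))))
  scaled-num h c w n = trans (•-applyUpTo (ℚ→ℂ c) (λ i → combination h (λ l → w l i)) n)
    (sym (toList-tabulate (λ i → scaled h c (λ l → w l i)) n))

  •-•-applyUpTo : ∀ x y (f : ℕ → ℂ) n → x • (y • List.map f (upTo n)) ≡ applyUpTo (λ k → x *ᶜ (y *ᶜ f k)) n
  •-•-applyUpTo x y f n = trans (cong (λ P → x • (y • P)) (Listₚ.map-upTo f n))
    (trans (cong (x •_) (•-applyUpTo y f n)) (•-applyUpTo x (λ k → y *ᶜ f k) n))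

  limit-num : ∀ {m} (h : Vec ℂ m) f (a : ℕ → ℕ) n →
    ℚ→ℂ f • (eval (toList h) 1ᶜ • List.map (λ k → ℕ→ℂ (a k)) (upTo n))
      ≡ toList (tabulate {n = n} (λ i → limitCoeff h f (a (toℕ i))))
  limit-num h f a n = trans (•-•-applyUpTo (ℚ→ℂ f) (eval (toList h) 1ᶜ) (λ k → ℕ→ℂ (a k)) n)
    (sym (toList-tabulate (λ k → limitCoeff h f (a k)) n))

  ⟶ᶜ-resp-≡ : ∀ (z z′ : ℕ → ℂ) w w′ → (∀ r → z r ≡ z′ r) → w ≡ w′ → z ⟶ᶜ w → z′ ⟶ᶜ w′
  ⟶ᶜ-resp-≡ z z′ w w′ z≡z′ w≡w′ z⟶w ε 0<ε = proj₁ (z⟶w ε 0<ε) , λ r R≤r →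
    transport (z r) (z′ r) w w′ (z≡z′ r) w≡w′ (proj₂ (z⟶w ε 0<ε) r R≤r)
    where
    transport : ∀ x x′ y y′ → x ≡ x′ → y ≡ y′ → ∣ x -ᶜ y ∣² <ʳ fromℚ (ε * ε) → ∣ x′ -ᶜ y′ ∣² <ʳ fromℚ (ε * ε)
    transport x x′ y y′ refl refl p = p

  coefficientwise-⟶ : ∀ n (S : ℕ → ℛ) L (z : ℕ → ℕ → ℂ) (w : ℕ → ℂ) →
    (∀ r → num (S r) ≡ toList (tabulate {n = n} (λ i → z r (toℕ i)))) → (∀ r → den (S r) ≡ den L) →
    num L ≡ toList (tabulate {n = n} (λ i → w (toℕ i))) →
    (∀ i → (λ r → z r i) ⟶ᶜ w i) → S ⟶ L
  coefficientwise-⟶ n S L z w numS≡ denS≡ numL≡ z⟶w = den L , den≢0 L , n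
    , (λ r → tabulate (λ i → z r (toℕ i))) , tabulate (λ i → w (toℕ i))
    , (λ r → num≡⇒≃ (S r) (toList (tabulate (λ i → z r (toℕ i))) / den L ⟨ den≢0 L ⟩) (numS≡ r) (denS≡ r))
    , num≡⇒≃ L (toList (tabulate (λ i → w (toℕ i))) / den L ⟨ den≢0 L ⟩) numL≡ refl
    , λ i → ⟶ᶜ-resp-≡ (λ r → z r (toℕ i)) (λ r → lookup (tabulate (λ i → z r (toℕ i))) i)
        (w (toℕ i)) (lookup (tabulate (λ i → w (toℕ i))) i)
        (λ r → sym (Vecₚ.lookup∘tabulate (λ i → z r (toℕ i)) i))
        (sym (Vecₚ.lookup∘tabulate (λ i → w (toℕ i)) i)) (z⟶w (toℕ i))

  scaled-⟶ : ∀ b .{{_ : ℕ.NonTrivial b}} {m} (h : Vec ℂ m) (c : ℕ → ℚ) f (w : ℕ → ℕ → ℚ) a →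
    (∀ l → Dilation.O b (λ r → c r * w r l - f * ι a)) →
    (λ r → scaled h (c r) (w r)) ⟶ᶜ limitCoeff h f a
  scaled-⟶ b h c f w a w→a = Convergence.combination-⟶ b h (λ r → scaled h (c r) (w r)) (limitCoeff h f a)
    (λ r l → c r * w r l - f * ι a) (λ r → part-difference h (c r) (w r) f a) (λ l _ → w→a l)

  scaled-⟶ℛ : ∀ b .{{_ : ℕ.NonTrivial b}} {m} (h : Vec ℂ m) (w : ℕ → ℕ → ℕ → ℚ) (a : ℕ → ℕ)
    n (S : ℕ → ℛ) L (k : ℕ → ℕ) (k≢0 : ∀ r → ℕ.NonZero (k r)) j (j≢0 : ℕ.NonZero j) →
    (∀ r → num (S r) ≡ applyUpTo (λ i → combination h (λ l → w r l i)) n) → (∀ r → den (S r) ≡ den L) →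
    num L ≡ eval (toList h) 1ᶜ • List.map (λ k → ℕ→ℂ (a k)) (upTo n) →
    (∀ i l → Dilation.O b (λ r → recip (k r) {{k≢0 r}} * w r l i - recip j {{j≢0}} * ι (a i))) →
    (λ r → _/ℕ_ (S r) (k r) {{k≢0 r}}) ⟶ _/ℕ_ L j {{j≢0}}
  scaled-⟶ℛ b h w a n S L k k≢0 j j≢0 numS≡ denS≡ numL≡ w→a = coefficientwise-⟶ n
    (λ r → _/ℕ_ (S r) (k r) {{k≢0 r}}) (_/ℕ_ L j {{j≢0}})
    (λ r i → scaled h ((ℤ.+ 1 ℚ./ k r) {{k≢0 r}}) (λ l → w r l i))
    (λ i → limitCoeff h ((ℤ.+ 1 ℚ./ j) {{j≢0}}) (a i))
    (λ r → trans (cong (ℚ→ℂ ((ℤ.+ 1 ℚ./ k r) {{k≢0 r}}) •_) (numS≡ r)) (scaled-num h ((ℤ.+ 1 ℚ./ k r) {{k≢0 r}}) (w r) n))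
    denS≡
    (trans (cong (ℚ→ℂ ((ℤ.+ 1 ℚ./ j) {{j≢0}}) •_) numL≡) (limit-num h ((ℤ.+ 1 ℚ./ j) {{j≢0}}) a n))
    (λ i → scaled-⟶ b h (λ r → (ℤ.+ 1 ℚ./ k r) {{k≢0 r}}) ((ℤ.+ 1 ℚ./ j) {{j≢0}}) (λ r l → w r l i) (a i) (w→a i))

  -- With t = k + 1 as the variable, h / (1 - x)^(m + 1) has the coefficients G t.
  module Numerators (b : ℕ) .{{b≥2 : ℕ.NonTrivial b}} {m : ℕ} (h : Vec ℂ m) where
    G : ℕ → ℂ
    G t = combination h (λ l → binom m (ι t - ι l))

    expansion : Series
    expansion = fromℕ (G ∘ suc)

    numeratorCoeff : ℕ → ℕ → ℂ
    numeratorCoeff r i = combination h (λ l → Dilation.numerator b m r l i)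

    -- The denominator stays fixed for all r. Cutting the numerator off at length m loses nothing,
    -- since its later coefficients vanish.
    iterate : ℕ → ℛ
    iterate r = applyUpTo (λ i → combination h (λ l → Dilation.numerator b m r l i)) m /[1-x]^ suc m

    Φ^-expansion : ∀ r k → Φ^ b r expansion k ≡ fromℕ (λ k → G (b ℕ.^ r ℕ.* suc k)) k
    Φ^-expansion r = Φ^-fromℕ b {{ℕ.nonTrivial⇒nonZero b}} r G

    hasExpansion : (toList h /[1-x]^ suc m) HasExpansion expansion
    hasExpansion = (ℤ.+ 0 , λ k k<0 → ≐⇒≈ᶜ (≡⇒≐ (negative⇒0 (G ∘ suc) k k<0))) , λ k → ≐⇒≈ᶜ (λ p N →
      trans (1-x^-· h (suc m) (λ l k → binom m (ι (suc k) - ι l)) expansion (λ _ → refl) k p N) (match k p N))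
      where
      match : ∀ k → fromℕ (λ k → combination h (λ l → D^ (suc m) (λ k → binom m (ι (suc k) - ι l)) k)) k
                  ≐ coeffℤ (toList h) k
      match (ℤ.+ i)  p N = trans (combination-cong h (λ l l<m → D^-binom m l (ℕₚ.<⇒≤ l<m) i) p N)
                                 (combination-mono h i p N)
      match -[1+ i ] p N = refl

    iterate-hasExpansion : ∀ r → iterate r HasExpansion Φ^ b r expansion
    iterate-hasExpansion r =
      (ℤ.+ 0 , λ k k<0 → ≐⇒≈ᶜ (≡⇒≐ (trans (Φ^-expansion r k) (negative⇒0 (λ k → G (b ℕ.^ r ℕ.* suc k)) k k<0)))) ,
      λ k → ≐⇒≈ᶜ (λ p N →
        trans (1-x^-· h (suc m) (λ l k → binom m (ι (b ℕ.^ r ℕ.* suc k) - ι l)) (Φ^ b r expansion) (Φ^-expansion r) k p N)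
              (match k p N))
      where
      s : ℕ → ℂ
      s i = combination h (λ l → D^ (suc m) (λ k → binom m (ι (b ℕ.^ r ℕ.* suc k) - ι l)) i)
      coefficient : ∀ i → Dec (i ℕ.< m) → s i ≐ coeff (applyUpTo (numeratorCoeff r) m) i
      coefficient i (yes i<m) = ≡⇒≐ (sym (coeff-applyUpTo (numeratorCoeff r) i<m))
      -- The degree bound on h enters here: only monomials x^l with l < m occur, and for these the
      -- dilated numerators end before x^m.
      coefficient i (no  i≮m) p N = trans
        (combination-0 h (λ l l<m → D^-dilated-binom-vanishes m (b ℕ.^ r) l l<m i (ℕₚ.≮⇒≥ i≮m)) p N)
        (≡⇒≐ (sym (coeff-applyUpTo-≥ (numeratorCoeff r) (ℕₚ.≮⇒≥ i≮m))) p N)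
      match : ∀ k → fromℕ s k ≐ coeffℤ (applyUpTo (numeratorCoeff r) m) k
      match (ℤ.+ i)  = coefficient i (i ℕₚ.<? m)
      match -[1+ i ] p N = refl

    error-vanishes : ∀ i l → Dilation.O b (λ r → Dilation.recip-pow b r m * Dilation.numerator b m r l i
                                               - Dilation.recip-! b m * ι (eulerian m i))
    error-vanishes i l = Dilation.O-cong b
      (λ r → cong (λ x → Dilation.recip-pow b r m * Dilation.numerator b m r l i - Dilation.recip-! b m * x)
        (sym (eulerian≡D^ m i)))
      (Dilation.numerator-limit b m l i)

    iterate-⟶ :
      (λ r → _/ℕ_ (iterate r) (b ℕ.^ (r ℕ.* m)) {{b^m≢0 b (r ℕ.* m)}})
        ⟶ _/ℕ_ ((eval (toList h) 1ᶜ • eulerianPoly m) /[1-x]^ suc m) (m !) {{m ℕₚ.!≢0}}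
    iterate-⟶ = scaled-⟶ℛ b {{b≥2}} h (Dilation.numerator b {{b≥2}} m) (eulerian m) m
      iterate ((eval (toList h) 1ᶜ • eulerianPoly m) /[1-x]^ suc m)
      (λ r → b ℕ.^ (r ℕ.* m)) (λ r → b^m≢0 b (r ℕ.* m) {{b≥2}}) (m !) (m ℕₚ.!≢0)
      (λ r → refl) (λ r → refl) refl error-vanishes

open Lemmas using (module Numerators)
open import Data.Nat using (ℕ; NonTrivial; _*_; _∸_; _^_; _!)
open import Data.Nat.Properties using (_!≢0)
open import Data.Vec using (Vec; toList)
open import Data.Product using (Σ-syntax; _×_)

theorem1p1 : ∀ (b n : ℕ) .{{_ : NonTrivial b}} .{{_ : NonTrivial n}} (h : Vec ℂ (n ∸ 1)) →
    Σ[ S ∈ (ℕ → ℛ) ]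
      (∀ r → IsΦ^ b r (toList h /[1-x]^ n) (S r))
    × ((λ r → _/ℕ_ (S r) (b ^ (r * (n ∸ 1))) {{b^m≢0 b (r * (n ∸ 1))}})
        ⟶ _/ℕ_ ((eval (toList h) 1ᶜ • eulerianPoly (n ∸ 1)) /[1-x]^ n) ((n ∸ 1) !) {{(n ∸ 1) !≢0}})
theorem1p1 b (suc m) h =
  iterate , (λ r → expansion , hasExpansion , iterate-hasExpansion r) , iterate-⟶
  where open Numerators b h
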